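{- Let $\mathcal{X}$ be a hereditary small graph class. Then the contiguity of $\mathcal{X}$ is $O(\log^2 n)$; that is, there is a function $k(n)=O(\log^2 n)$ such that every $n$-vertex graph in $\mathcal{X}$ has contiguity at most $k(n)$.
   Context: A class of graphs is closed under isomorphism; it is hereditary if closed under taking induced subgraphs. $\mathcal{X}_n$ denotes the set of graphs in $\mathcal{X}$ with vertex set $[n]$; $\mathcal{X}$ is small if there is a constant $c$ with $|\mathcal{X}_n|\le n!\cdot c^n$ for all $n$. The contiguity $\mathrm{ctg}(G)$ of a graph $G$ is the minimum integer $k$ such that there is a linear order of $V(G)$ in which the neighborhood of each vertex can be partitioned into at most $k$ intervals. -}

module Defs where

open import Data.Nat using (ℕ; zero; suc; _+_; _*_; _^_; _≤_; _!)

open import Data.Fin using (Fin) renaming (_≤_ to _≤F_)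
open import Data.Bool using (Bool; true; false)
open import Data.List using (List; length)
open import Data.List.Relation.Unary.All using (All)
open import Data.List.Relation.Unary.Any using (Any)
open import Data.List.Relation.Unary.AllPairs using (AllPairs)
open import Data.Product using (Σ; _×_; _,_; ∃; ∃-syntax)
open import Relation.Binary.PropositionalEquality using (_≡_; _≢_)
open import Function.Definitions using (Injective)
open import Function.Bundles using (_⇔_)

record Graph (n : ℕ) : Set where
  field
    adj    : Fin n → Fin n → Bool
    sym    : ∀ i j → adj i j ≡ adj j i
    irrefl : ∀ i → adj i i ≡ false
open Graph public

Distinct : ∀ {n} → Graph n → Graph n → Set
Distinct G H = ∃[ i ] ∃[ j ] (adj G i j ≢ adj H i j)

GraphProp : Set₁
GraphProp = (n : ℕ) → Graph n → Set

Iso : ∀ {n m} → Graph n → Graph m → Set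
Iso {n} {m} G H =
  Σ (Fin n → Fin m) λ σ → Σ (Fin m → Fin n) λ τ →
    (∀ i → τ (σ i) ≡ i) × (∀ j → σ (τ j) ≡ j) ×
    (∀ i j → adj H (σ i) (σ j) ≡ adj G i j)

induce : ∀ {m n} (f : Fin m → Fin n) → Injective _≡_ _≡_ f → Graph n → Graph m
induce f _ G = record
  { adj    = λ i j → adj G (f i) (f j)
  ; sym    = λ i j → sym G (f i) (f j)
  ; irrefl = λ i → irrefl G (f i)
  }

IsClass : GraphProp → Set
IsClass X = ∀ {n m} (G : Graph n) (H : Graph m) → Iso G H → X n G → X m H

Hereditary : GraphProp → Set
Hereditary X = ∀ {m n} (f : Fin m → Fin n) (inj : Injective _≡_ _≡_ f)
                 (G : Graph n) → X n G → X m (induce f inj G)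

-- Small: ∃ c, |X_n| ≤ n! · c^n for all n.  Stated constructively:
-- every duplicate-free list of members of X_n has length ≤ n! · c^n.
Small : GraphProp → Set
Small X = ∃[ c ] ∀ n (gs : List (Graph n)) → All (X n) gs →
            AllPairs Distinct gs → length gs ≤ (n !) * (c ^ n)

Interval : ℕ → Set
Interval n = Fin n × Fin n

InInterval : ∀ {n} → Fin n → Interval n → Set
InInterval p (a , b) = (a ≤F p) × (p ≤F b)

-- ctg(G) ≤ k: there is a linear order of V(G) (given by an injective, hence
-- bijective, position map pos : Fin n → Fin n) such that for each vertex v
-- there is a list of at most k intervals of positions whose union is
-- exactly the neighbourhood of v.
CtgAtMost : ∀ {n} → ℕ → Graph n → Set
CtgAtMost {n} k G =
  Σ (Fin n → Fin n) λ pos → Injective _≡_ _≡_ pos ×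
    (∀ v → Σ (List (Interval n)) λ Is → (length Is ≤ k) ×
       (∀ u → (adj G v u ≡ true) ⇔ Any (InInterval (pos u)) Is))

{-# OPTIONS --safe #-}
module Submission where

-- Two counting facts follow from smallness.  If the vertices of B have pairwise
-- distinct traces on a set A of r vertices, then the injective sequences in B,
-- put next to a fixed labelling of A, induce distinct labelled graphs;
-- comparing their number with n! cⁿ gives |B| = O(r log n), and for constant r
-- it bounds the VC dimension d of the neighbourhoods.  Haussler's packing
-- argument turns this into: for every weighting of the vertices, among any m
-- vertices there are two, x and y, whose neighbourhoods differ on an
-- O(log n / m) fraction of the weight.  Welzl's reweighting then applies: order
-- the vertices other than x recursively, after doubling the weight of each v
-- that separates x from y, and insert x right after y.  The total weight ends up
-- at most n · ∏ (1 + O(log n / m)) = n^O(log n), so each v separates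
-- only O(log² n) of the chosen pairs, and its neighbourhood changes
-- along the order only O(log² n) times.

open import Defs
open import Data.Bool using (Bool; true; false; not; _xor_; T; T?)
import Data.Bool.Properties as Bool
open import Data.Empty using (⊥; ⊥-elim)
open import Data.Fin using (Fin; zero; suc)
import Data.Fin.Properties as Fin
open import Data.List as List using (List; []; _∷_; _++_; map; length; concatMap; filter; filterᵇ; deduplicate; allFin)
open import Data.List.Membership.Propositional using (_∈_; _∉_; find)
open import Data.List.Membership.Propositional.Properties using (∈-filter⁻; ∈-deduplicate⁺; ∈-lookup; ∈-∃++; ∈-allFin)
open import Data.List.Properties as List using (length-++; length-map; length-tabulate; length-deduplicate; filter-all; map-++)
open import Data.List.Relation.Binary.Permutation.Propositional using (_↭_; ↭-refl; ↭-trans; ↭-prep; ↭-swap)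
open import Data.List.Relation.Binary.Permutation.Propositional.Properties using (↭-length; ∈-resp-↭; shift)
open import Data.List.Relation.Unary.All as All using (All; []; _∷_)
import Data.List.Relation.Unary.All.Properties as All
open import Data.List.Relation.Unary.AllPairs as AllPairs using (AllPairs; []; _∷_)
import Data.List.Relation.Unary.AllPairs.Properties as AllPairs
open import Data.List.Relation.Unary.Any using (Any; here; there; index)
open import Data.List.Relation.Unary.Any.Properties using (lookup-index)
open import Data.List.Relation.Unary.Unique.DecPropositional.Properties using (deduplicate-!)
open import Data.List.Relation.Unary.Unique.Propositional using (Unique)
open import Data.Nat using (ℕ; zero; suc; _+_; _*_; _^_; _!; _≤_; _<_; _⊔_; _⊓_; z≤n; s≤s; s≤s⁻¹; NonZero; >-nonZero; >-nonZero⁻¹)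
open import Data.Nat.DivMod using (_/_; _%_; m≡m%n+[m/n]*n; m%n<n; m/n*n≤m)
open import Data.Nat.ListAction using (sum)
open import Data.Nat.ListAction.Properties using (sum-++)
open import Data.Nat.Logarithm using (⌊log₂_⌋; ⌊log₂⌋-mono-≤; ⌊log₂[2^n]⌋≡n)
open import Data.Nat.Properties
open import Data.Nat.Tactic.RingSolver using (solve-∀)
open import Data.Product using (_×_; _,_; proj₁; proj₂; ∃-syntax; Σ-syntax)
open import Data.Sum using (_⊎_; inj₁; inj₂)
open import Data.Vec as Vec using (Vec; []; _∷_; lookup; toList)
import Data.Vec.Membership.Propositional as Vec
open import Data.Vec.Properties as Vec using (∷-injectiveˡ; ∷-injectiveʳ; lookup-map; length-toList)
open import Data.Vec.Relation.Unary.Any as VecAny using (here; there)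
import Data.Vec.Relation.Unary.Any.Properties as VecAny
open import Function using (_∘_; _on_; _⇔_; mk⇔; Equivalence)
open import Function.Definitions using (Injective)
open import Relation.Binary.Definitions using (Decidable)
open import Relation.Binary.PropositionalEquality as ≡ using (_≡_; _≢_; refl; cong; cong₂; subst; subst₂)
open import Relation.Nullary using (¬_; ¬?; contradiction; yes; no; does)

private
  variable
    A B : Set
    r : ℕ

-- Finite sums

∑ : List A → (A → ℕ) → ℕ
∑ xs f = sum (map f xs)

∑-mono : ∀ (xs : List A) {f g : A → ℕ} → (∀ x → f x ≤ g x) → ∑ xs f ≤ ∑ xs g
∑-mono []       f≤g = z≤n
∑-mono (x ∷ xs) f≤g = +-mono-≤ (f≤g x) (∑-mono xs f≤g)

∑-cong : ∀ (xs : List A) {f g : A → ℕ} → (∀ x → f x ≡ g x) → ∑ xs f ≡ ∑ xs g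
∑-cong []       f≡g = refl
∑-cong (x ∷ xs) f≡g = cong₂ _+_ (f≡g x) (∑-cong xs f≡g)

+-interchange : ∀ a b c d → (a + b) + (c + d) ≡ (a + c) + (b + d)
+-interchange = solve-∀

∑-+ : ∀ (xs : List A) (f g : A → ℕ) → ∑ xs (λ x → f x + g x) ≡ ∑ xs f + ∑ xs g
∑-+ []       f g = refl
∑-+ (x ∷ xs) f g = ≡.trans (cong (f x + g x +_) (∑-+ xs f g))
                           (+-interchange (f x) (g x) (∑ xs f) (∑ xs g))

∑-* : ∀ (xs : List A) c (f : A → ℕ) → ∑ xs (λ x → c * f x) ≡ c * ∑ xs f
∑-* []       c f = ≡.sym (*-zeroʳ c)
∑-* (x ∷ xs) c f = ≡.trans (cong (c * f x +_) (∑-* xs c f))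
                           (≡.sym (*-distribˡ-+ c (f x) (∑ xs f)))

∑-const : ∀ (xs : List A) c → ∑ xs (λ _ → c) ≡ length xs * c
∑-const []       c = refl
∑-const (x ∷ xs) c = cong (c +_) (∑-const xs c)

∑-comm : ∀ (xs : List A) (ys : List B) (f : A → B → ℕ) →
         ∑ xs (λ x → ∑ ys (f x)) ≡ ∑ ys (λ y → ∑ xs (λ x → f x y))
∑-comm []       ys f = ≡.sym (≡.trans (∑-const ys 0) (*-zeroʳ (length ys)))
∑-comm (x ∷ xs) ys f = ≡.trans (cong (∑ ys (f x) +_) (∑-comm xs ys f))
                               (≡.sym (∑-+ ys (f x) (λ y → ∑ xs (λ x → f x y))))

∑-++ : ∀ (xs ys : List A) (f : A → ℕ) → ∑ (xs ++ ys) f ≡ ∑ xs f + ∑ ys f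
∑-++ xs ys f = ≡.trans (cong sum (map-++ f xs ys)) (sum-++ (map f xs) (map f ys))

∑-map : ∀ (xs : List A) (g : A → B) (f : B → ℕ) → ∑ (map g xs) f ≡ ∑ xs (f ∘ g)
∑-map xs g f = cong sum (≡.sym (List.map-∘ xs))

∑-concatMap : ∀ (xs : List A) (g : A → List B) (f : B → ℕ) →
              ∑ (concatMap g xs) f ≡ ∑ xs (λ x → ∑ (g x) f)
∑-concatMap []       g f = refl
∑-concatMap (x ∷ xs) g f = ≡.trans (∑-++ (g x) (concatMap g xs) f)
                                   (cong (∑ (g x) f +_) (∑-concatMap xs g f))

-- Weighted edges of the cube

cube : ∀ r → List (Vec Bool r)
cube zero    = [] ∷ []
cube (suc r) = map (false ∷_) (cube r) ++ map (true ∷_) (cube r)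

∑-cube : ∀ (w : Vec Bool (suc r) → ℕ) →
         ∑ (cube (suc r)) w ≡ ∑ (cube r) (w ∘ (false ∷_)) + ∑ (cube r) (w ∘ (true ∷_))
∑-cube {r} w = ≡.trans (∑-++ (map (false ∷_) (cube r)) (map (true ∷_) (cube r)) w)
                       (cong₂ _+_ (∑-map (cube r) (false ∷_) w) (∑-map (cube r) (true ∷_) w))

-- An edge weighs the minimum of its two endpoints, so for a 0/1-valued `w` this counts the edges of
-- the unit distance graph on the support of `w`.
edges : ∀ r → (Vec Bool r → ℕ) → ℕ
edges zero    w = 0
edges (suc r) w = edges r (w ∘ (false ∷_)) + edges r (w ∘ (true ∷_))
                + ∑ (cube r) (λ f → w (false ∷ f) ⊓ w (true ∷ f))

-- The pairs (a, b) and (c, d) have join (c, b) and meet (a, d). If a ≤ d, the meet contributes a,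
-- which dominates `a ⊓ b`; if d ≤ a, it contributes d, which dominates `c ⊓ d`. The other terms
-- compare by monotonicity.
⊓-supermodular : ∀ {a b c d} → a ≤ c → d ≤ b → a ⊓ b + c ⊓ d ≤ c ⊓ b + a ⊓ d
⊓-supermodular {a} {b} {c} {d} a≤c d≤b with ≤-total a d
... | inj₁ a≤d = subst (a ⊓ b + c ⊓ d ≤_) (+-comm (a ⊓ d) (c ⊓ b))
                   (+-mono-≤ (≤-trans (m⊓n≤m a b) (≤-reflexive (≡.sym (m≤n⇒m⊓n≡m a≤d))))
                             (⊓-monoʳ-≤ c d≤b))
... | inj₂ d≤a = +-mono-≤ (⊓-monoˡ-≤ b a≤c)
                          (≤-trans (m⊓n≤n c d) (≤-reflexive (≡.sym (m≥n⇒m⊓n≡n d≤a))))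

⊓-⊔-exchange : ∀ a b c d → a ⊓ b + c ⊓ d ≤ (a ⊔ c) ⊓ (b ⊔ d) + (a ⊓ c) ⊓ (b ⊓ d)
⊓-⊔-exchange a b c d with ≤-total a c | ≤-total b d
... | inj₁ a≤c | inj₁ b≤d
  rewrite m≤n⇒m⊔n≡n a≤c | m≤n⇒m⊓n≡m a≤c | m≤n⇒m⊔n≡n b≤d | m≤n⇒m⊓n≡m b≤d = ≤-reflexive (+-comm (a ⊓ b) (c ⊓ d))
... | inj₁ a≤c | inj₂ d≤b
  rewrite m≤n⇒m⊔n≡n a≤c | m≤n⇒m⊓n≡m a≤c | m≥n⇒m⊔n≡m d≤b | m≥n⇒m⊓n≡n d≤b = ⊓-supermodular a≤c d≤b
... | inj₂ c≤a | inj₁ b≤d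
  rewrite m≥n⇒m⊔n≡m c≤a | m≥n⇒m⊓n≡n c≤a | m≤n⇒m⊔n≡n b≤d | m≤n⇒m⊓n≡m b≤d =
    ≤-trans (≤-reflexive (+-comm (a ⊓ b) (c ⊓ d))) (⊓-supermodular c≤a b≤d)
... | inj₂ c≤a | inj₂ d≤b
  rewrite m≥n⇒m⊔n≡m c≤a | m≥n⇒m⊓n≡n c≤a | m≥n⇒m⊔n≡m d≤b | m≥n⇒m⊓n≡n d≤b = ≤-refl

-- `edges` is a sum of minima over the edges of the cube, so `⊓-⊔-exchange` applies edge by edge.
edges-⊔-⊓ : ∀ r (u v : Vec Bool r → ℕ) →
            edges r u + edges r v ≤ edges r (λ f → u f ⊔ v f) + edges r (λ f → u f ⊓ v f)
edges-⊔-⊓ zero    u v = z≤n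
edges-⊔-⊓ (suc r) u v = begin
  (e₀ u + e₁ u + s u) + (e₀ v + e₁ v + s v)
    ≡⟨ rearrange (e₀ u) (e₁ u) (s u) (e₀ v) (e₁ v) (s v) ⟩
  (e₀ u + e₀ v) + (e₁ u + e₁ v) + (s u + s v)
    ≤⟨ +-mono-≤ (+-mono-≤ (edges-⊔-⊓ r (u ∘ (false ∷_)) (v ∘ (false ∷_)))
                          (edges-⊔-⊓ r (u ∘ (true ∷_)) (v ∘ (true ∷_))))
                s≤ ⟩
  (e₀ u⊔v + e₀ u⊓v) + (e₁ u⊔v + e₁ u⊓v) + (s u⊔v + s u⊓v)
    ≡⟨ rearrange (e₀ u⊔v) (e₁ u⊔v) (s u⊔v) (e₀ u⊓v) (e₁ u⊓v) (s u⊓v) ⟨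
  (e₀ u⊔v + e₁ u⊔v + s u⊔v) + (e₀ u⊓v + e₁ u⊓v + s u⊓v) ∎
  where
  open ≤-Reasoning
  u⊔v u⊓v : Vec Bool (suc r) → ℕ
  u⊔v f = u f ⊔ v f
  u⊓v f = u f ⊓ v f
  e₀ e₁ s : (Vec Bool (suc r) → ℕ) → ℕ
  e₀ w = edges r (w ∘ (false ∷_))
  e₁ w = edges r (w ∘ (true ∷_))
  s  w = ∑ (cube r) (λ f → w (false ∷ f) ⊓ w (true ∷ f))
  rearrange : ∀ a b c a′ b′ c′ → (a + b + c) + (a′ + b′ + c′) ≡ (a + a′) + (b + b′) + (c + c′)
  rearrange = solve-∀
  s≤ : s u + s v ≤ s u⊔v + s u⊓v
  s≤ = subst₂ _≤_ (∑-+ (cube r) _ _) (∑-+ (cube r) _ _)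
         (∑-mono (cube r) (λ f → ⊓-⊔-exchange (u (false ∷ f)) (u (true ∷ f)) (v (false ∷ f)) (v (true ∷ f))))

-- Realising all patterns forces the entries of `I` to be distinct, so this is VC shattering by the
-- support of `w`.
Shatters : ∀ {r} → ℕ → (Vec Bool r → ℕ) → Set
Shatters {r} d w = Σ[ I ∈ Vec (Fin r) d ] ∀ (p : Vec Bool d) →
                     ∃[ f ] 0 < w f × Vec.map (lookup f) I ≡ p

map-lookup-suc : ∀ {d b} (f : Vec Bool r) (I : Vec (Fin r) d) →
                 Vec.map (lookup (b ∷ f)) (Vec.map suc I) ≡ Vec.map (lookup f) I
map-lookup-suc f []      = refl
map-lookup-suc f (i ∷ I) = cong (lookup f i ∷_) (map-lookup-suc f I)

shatters-⊔ : ∀ {d} (w : Vec Bool (suc r) → ℕ) →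
             Shatters d (λ f → w (false ∷ f) ⊔ w (true ∷ f)) → Shatters d w
shatters-⊔ {d = d} w (I , sh) = Vec.map suc I , sh′
  where
  sh′ : ∀ p → ∃[ f ] 0 < w f × Vec.map (lookup f) (Vec.map suc I) ≡ p
  sh′ p with sh p
  ... | f , w>0 , eq with ⊔-sel (w (false ∷ f)) (w (true ∷ f))
  ...   | inj₁ e = false ∷ f , subst (0 <_) e w>0 , ≡.trans (map-lookup-suc f I) eq
  ...   | inj₂ e = true ∷ f , subst (0 <_) e w>0 , ≡.trans (map-lookup-suc f I) eq

-- A positive minimum means that both one-bit extensions lie in the support, so the first coordinate
-- can join the shattered set.
shatters-⊓ : ∀ {d} (w : Vec Bool (suc r) → ℕ) →
             Shatters d (λ f → w (false ∷ f) ⊓ w (true ∷ f)) → Shatters (suc d) w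
shatters-⊓ {d = d} w (I , sh) = zero ∷ Vec.map suc I , sh′
  where
  sh′ : ∀ p → ∃[ f ] 0 < w f × Vec.map (lookup f) (zero ∷ Vec.map suc I) ≡ p
  sh′ (b ∷ p) with sh p
  sh′ (false ∷ p) | f , w>0 , eq =
    false ∷ f , ≤-trans w>0 (m⊓n≤m _ _) , cong (false ∷_) (≡.trans (map-lookup-suc f I) eq)
  sh′ (true ∷ p) | f , w>0 , eq =
    true ∷ f , ≤-trans w>0 (m⊓n≤n (w (false ∷ f)) _) , cong (true ∷_) (≡.trans (map-lookup-suc f I) eq)

⊓+⊔≡+ : ∀ a b → (a ⊔ b) + (a ⊓ b) ≡ a + b
⊓+⊔≡+ a b with ≤-total a b
... | inj₁ a≤b rewrite m≤n⇒m⊔n≡n a≤b | m≤n⇒m⊓n≡m a≤b = +-comm b a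
... | inj₂ b≤a rewrite m≥n⇒m⊔n≡m b≤a | m≥n⇒m⊓n≡n b≤a = refl

-- Weighted form of Haussler's bound on the unit distance graph of a set
-- system of bounded VC dimension.  The two halves u, v of the cube are
-- replaced by max(u, v) and min(u, v), which keeps the total weight, does not
-- decrease the number of edges, and drops the dimension of the minimum by one.
edges-bound : ∀ r d (w : Vec Bool r → ℕ) →
              edges r w + ∑ (cube r) w ≤ d * ∑ (cube r) w ⊎ Shatters d w
edges-bound zero zero w with w [] in eq
... | zero  = inj₁ z≤n
... | suc _ = inj₂ ([] , λ { [] → [] , subst (0 <_) (≡.sym eq) (s≤s z≤n) , refl })
edges-bound zero (suc d) w = inj₁ (m≤m+n _ _)
-- For `d = 0` the inequality says that the total weight vanishes; a positive weight anywhere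
-- shatters the empty set of coordinates.
edges-bound (suc r) zero w with edges-bound r zero (w ∘ (false ∷_)) | edges-bound r zero (w ∘ (true ∷_))
... | inj₂ (_ , sh) | _ = inj₂ ([] , λ { [] → let f , w>0 , _ = sh [] in false ∷ f , w>0 , refl })
... | inj₁ _ | inj₂ (_ , sh) = inj₂ ([] , λ { [] → let f , w>0 , _ = sh [] in true ∷ f , w>0 , refl })
... | inj₁ e₀ | inj₁ e₁ = inj₁ (begin
    E₀ + E₁ + M + ∑ (cube (suc r)) w   ≡⟨ cong (E₀ + E₁ + M +_) (∑-cube w) ⟩
    E₀ + E₁ + M + (W₀ + W₁)            ≤⟨ +-monoˡ-≤ (W₀ + W₁) (+-monoʳ-≤ (E₀ + E₁) M≤) ⟩
    E₀ + E₁ + W₀ + (W₀ + W₁)           ≡⟨ rearrange E₀ E₁ W₀ W₁ ⟩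
    (E₀ + W₀) + (E₁ + W₁) + W₀         ≤⟨ +-mono-≤ (+-mono-≤ e₀ e₁) (≤-trans (m≤n+m W₀ E₀) e₀) ⟩
    0 ∎)
  where
  open ≤-Reasoning
  E₀ = edges r (w ∘ (false ∷_))
  E₁ = edges r (w ∘ (true ∷_))
  W₀ = ∑ (cube r) (w ∘ (false ∷_))
  W₁ = ∑ (cube r) (w ∘ (true ∷_))
  M  = ∑ (cube r) (λ f → w (false ∷ f) ⊓ w (true ∷ f))
  M≤ : M ≤ W₀
  M≤ = ∑-mono (cube r) (λ f → m⊓n≤m (w (false ∷ f)) (w (true ∷ f)))
  rearrange : ∀ a b c d → a + b + c + (c + d) ≡ (a + c) + (b + d) + c
  rearrange = solve-∀
edges-bound (suc r) (suc d) w
  with edges-bound r (suc d) (λ f → w (false ∷ f) ⊔ w (true ∷ f))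
     | edges-bound r d (λ f → w (false ∷ f) ⊓ w (true ∷ f))
... | inj₂ sh | _ = inj₂ (shatters-⊔ w sh)
... | inj₁ _ | inj₂ sh = inj₂ (shatters-⊓ w sh)
... | inj₁ e⊔ | inj₁ e⊓ = inj₁ (begin
    E₀ + E₁ + m + ∑ (cube (suc r)) w  ≡⟨ cong (E₀ + E₁ + m +_) total ⟩
    E₀ + E₁ + m + (M + m)             ≤⟨ +-monoˡ-≤ (M + m) (+-monoˡ-≤ m (edges-⊔-⊓ r _ _)) ⟩
    E⊔ + E⊓ + m + (M + m)             ≡⟨ rearrange E⊔ E⊓ m M ⟩
    (E⊔ + M) + (E⊓ + m) + m           ≤⟨ +-monoˡ-≤ m (+-mono-≤ e⊔ e⊓) ⟩
    suc d * M + d * m + m             ≡⟨ collect d M m ⟩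
    suc d * (M + m)                   ≡⟨ cong (suc d *_) total ⟨
    suc d * ∑ (cube (suc r)) w ∎)
  where
  open ≤-Reasoning
  E₀ = edges r (w ∘ (false ∷_))
  E₁ = edges r (w ∘ (true ∷_))
  E⊔ = edges r (λ f → w (false ∷ f) ⊔ w (true ∷ f))
  E⊓ = edges r (λ f → w (false ∷ f) ⊓ w (true ∷ f))
  M  = ∑ (cube r) (λ f → w (false ∷ f) ⊔ w (true ∷ f))
  m  = ∑ (cube r) (λ f → w (false ∷ f) ⊓ w (true ∷ f))
  total : ∑ (cube (suc r)) w ≡ M + m
  total = ≡.trans (∑-cube w) (≡.trans (≡.sym (∑-+ (cube r) _ _))
            (≡.trans (∑-cong (cube r) (λ f → ≡.sym (⊓+⊔≡+ (w (false ∷ f)) (w (true ∷ f)))))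
                     (∑-+ (cube r) _ _)))
  rearrange : ∀ a b c d → a + b + c + (d + c) ≡ (a + d) + (b + c) + c
  rearrange = solve-∀
  collect : ∀ d M m → suc d * M + d * m + m ≡ suc d * (M + m)
  collect = solve-∀

-- Traces and packing

indicator : Bool → ℕ
indicator false = 0
indicator true  = 1

tuples : List A → ∀ r → List (Vec A r)
tuples U zero    = [] ∷ []
tuples U (suc r) = concatMap (λ y → map (y ∷_) (tuples U r)) U

∑-tuples : ∀ (U : List A) (f : Vec A (suc r) → ℕ) →
           ∑ (tuples U (suc r)) f ≡ ∑ U (λ y → ∑ (tuples U r) (λ ys → f (y ∷ ys)))
∑-tuples {r = r} U f = ≡.trans (∑-concatMap U (λ y → map (y ∷_) (tuples U r)) f)
                               (∑-cong U (λ y → ∑-map (tuples U r) (y ∷_) f))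

1⊓-subadditive : ∀ a b → 1 ⊓ (a + b) ≤ 1 ⊓ a + 1 ⊓ b
1⊓-subadditive zero    b = ≤-refl
1⊓-subadditive (suc a) b = m≤m+n 1 _

-- One factor is the minimum and the other is at most the sum. This turns the number of pairs that a
-- point splits into the size of its smaller side.
*≤+*⊓ : ∀ a b → a * b ≤ (a + b) * (a ⊓ b)
*≤+*⊓ a b with ≤-total a b
... | inj₁ a≤b rewrite m≤n⇒m⊓n≡m a≤b = ≤-trans (≤-reflexive (*-comm a b)) (*-monoˡ-≤ a (m≤n+m b a))
... | inj₂ b≤a rewrite m≥n⇒m⊓n≡n b≤a = *-monoˡ-≤ b (m≤m+n a b)

filterᵇ-comm : ∀ (p q : A → Bool) l → filterᵇ p (filterᵇ q l) ≡ filterᵇ q (filterᵇ p l)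
filterᵇ-comm p q []      = refl
filterᵇ-comm p q (x ∷ l) with p x in ep | q x in eq
... | false | false = filterᵇ-comm p q l
... | false | true  rewrite ep = filterᵇ-comm p q l
... | true  | false rewrite eq = filterᵇ-comm p q l
... | true  | true  rewrite ep | eq = cong (x ∷_) (filterᵇ-comm p q l)

module Traces {Y V : Set} (h : Y → V → Bool) where

  side : Y → Bool → List V → List V
  side y false = filterᵇ (not ∘ h y)
  side y true  = filterᵇ (h y)

  class : List V → Vec Y r → Vec Bool r → List V
  class l []       []      = l
  class l (y ∷ ys) (b ∷ f) = class (side y b l) ys f

  weight : List V → Vec Y r → Vec Bool r → ℕ
  weight l ys f = length (class l ys f)

  -- The term `1 ⊓ weight l ys f` counts each nonempty class once.
  #traces : List V → Vec Y r → ℕ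
  #traces l ys = ∑ (cube _) (λ f → 1 ⊓ weight l ys f)

  -- Repetitions in `U` count, so that a list can carry the weights of the points.
  separation : List Y → V → V → ℕ
  separation U x x′ = ∑ U (λ y → indicator (h y x xor h y x′))

  length-side : ∀ y l → length (side y false l) + length (side y true l) ≡ length l
  length-side y []      = refl
  length-side y (x ∷ l) with h y x
  ... | false = cong suc (length-side y l)
  ... | true  = ≡.trans (+-suc _ _) (cong suc (length-side y l))

  ∑-weight : ∀ l (ys : Vec Y r) → ∑ (cube r) (weight l ys) ≡ length l
  ∑-weight l []       = +-identityʳ (length l)
  ∑-weight l (y ∷ ys) = ≡.trans (∑-cube (weight l (y ∷ ys)))
    (≡.trans (cong₂ _+_ (∑-weight (side y false l) ys) (∑-weight (side y true l) ys)) (length-side y l))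

  side-comm : ∀ y b z c l → side y b (side z c l) ≡ side z c (side y b l)
  side-comm y false z false = filterᵇ-comm _ _
  side-comm y false z true  = filterᵇ-comm _ _
  side-comm y true  z false = filterᵇ-comm _ _
  side-comm y true  z true  = filterᵇ-comm _ _

  -- Filters commute, so the test by `y` may be made last: then it is each class of `ys` that gets
  -- split.
  class-side : ∀ y b l (ys : Vec Y r) f → class (side y b l) ys f ≡ side y b (class l ys f)
  class-side y b l []       []      = refl
  class-side y b l (z ∷ ys) (c ∷ f) =
    ≡.trans (cong (λ l → class l ys f) (side-comm z c y b l)) (class-side y b (side z c l) ys f)

  weight-side : ∀ y l (ys : Vec Y r) f →
                weight (side y false l) ys f + weight (side y true l) ys f ≡ weight l ys f
  weight-side y l ys f rewrite class-side y false l ys f | class-side y true l ys f =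
    length-side y (class l ys f)

  side-AllPairs : ∀ {R : V → V → Set} y b {l} → AllPairs R l → AllPairs R (side y b l)
  side-AllPairs y false = AllPairs.filter⁺ (T? ∘ not ∘ h y)
  side-AllPairs y true  = AllPairs.filter⁺ (T? ∘ h y)

  class-AllPairs : ∀ {R : V → V → Set} {l} (ys : Vec Y r) f → AllPairs R l → AllPairs R (class l ys f)
  class-AllPairs []       []      Rl = Rl
  class-AllPairs (y ∷ ys) (b ∷ f) Rl = class-AllPairs ys f (side-AllPairs y b Rl)

  #traces-mono : ∀ y l (ys : Vec Y r) → #traces l ys ≤ #traces l (y ∷ ys)
  #traces-mono {r} y l ys = begin
    ∑ (cube r) (λ f → 1 ⊓ weight l ys f)
      ≤⟨ ∑-mono (cube r) pointwise ⟩
    ∑ (cube r) (λ f → 1 ⊓ weight (side y false l) ys f + 1 ⊓ weight (side y true l) ys f)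
      ≡⟨ ∑-+ (cube r) _ _ ⟩
    #traces (side y false l) ys + #traces (side y true l) ys
      ≡⟨ ∑-cube (λ f → 1 ⊓ weight l (y ∷ ys) f) ⟨
    #traces l (y ∷ ys) ∎
    where
    open ≤-Reasoning
    pointwise : ∀ f → 1 ⊓ weight l ys f ≤ 1 ⊓ weight (side y false l) ys f + 1 ⊓ weight (side y true l) ys f
    pointwise f rewrite ≡.sym (weight-side y l ys f) =
      1⊓-subadditive (weight (side y false l) ys f) (weight (side y true l) ys f)

  sizes-indicator : ∀ y b l → length (side y (not b) l) ≡ ∑ l (λ x → indicator (b xor h y x))
  sizes-indicator y false []      = refl
  sizes-indicator y false (x ∷ l) with h y x
  ... | false = sizes-indicator y false l
  ... | true  = cong suc (sizes-indicator y false l)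
  sizes-indicator y true  []      = refl
  sizes-indicator y true  (x ∷ l) with h y x
  ... | false = cong suc (sizes-indicator y true l)
  ... | true  = sizes-indicator y true l

  splitPairs : Y → List V → ℕ
  splitPairs y l = length (side y false l) * length (side y true l)

  splitPairs-∷ : ∀ y x l →
    splitPairs y (x ∷ l) ≡ splitPairs y l + ∑ l (λ x′ → indicator (h y x xor h y x′))
  splitPairs-∷ y x l with h y x
  ... | false = ≡.trans (+-comm (length (side y true l)) _) (cong (splitPairs y l +_) (sizes-indicator y false l))
  ... | true  = ≡.trans (*-suc (length (side y false l)) _)
    (≡.trans (+-comm (length (side y false l)) _) (cong (splitPairs y l +_) (sizes-indicator y true l)))

  ∑-splitPairs-∷ : ∀ U x l → ∑ U (λ y → splitPairs y (x ∷ l)) ≡ ∑ U (λ y → splitPairs y l) + ∑ l (separation U x)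
  ∑-splitPairs-∷ U x l = ≡.trans (∑-cong U (λ y → splitPairs-∷ y x l))
    (≡.trans (∑-+ U _ _) (cong (∑ U (λ y → splitPairs y l) +_) (∑-comm U l _)))

  minSide : Y → List V → ℕ
  minSide y l = length (side y false l) ⊓ length (side y true l)

  module _ (U : List Y) (q e : ℕ) where

    -- With `e = N * k`, where `N` is the length of `U`, this says without division that `x` and
    -- `x′` are separated by at least a `k/q` fraction of `U`.
    Far : V → V → Set
    Far x x′ = e ≤ q * separation U x x′

    ∑-far : ∀ {x l} → All (Far x) l → length l * e ≤ q * ∑ l (separation U x)
    ∑-far []                      = z≤n
    ∑-far {x} {x′ ∷ l} (far ∷ fs) = ≤-trans (+-mono-≤ far (∑-far fs))
      (≤-reflexive (≡.sym (*-distribˡ-+ q (separation U x x′) (∑ l (separation U x)))))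

    -- Double counting of the pairs of elements of `l` together with a point of `U` that separates
    -- them. The diagonal term `length l * e` stands on the right in place of a subtraction.
    splitPairs-far : ∀ {l} → AllPairs Far l →
      length l * length l * e ≤ 2 * (q * ∑ U (λ y → splitPairs y l)) + length l * e
    splitPairs-far []                    = z≤n
    splitPairs-far {x ∷ l} (far ∷ fars) = begin
      suc n * suc n * e                            ≡⟨ square n e ⟩
      n * n * e + (2 * (n * e) + e)                ≤⟨ +-mono-≤ (splitPairs-far fars) (+-monoˡ-≤ e (*-monoʳ-≤ 2 (∑-far far))) ⟩
      (2 * (q * P) + n * e) + (2 * (q * S) + e)    ≡⟨ collect q P S n e ⟩
      2 * (q * (P + S)) + suc n * e                ≡⟨ cong (λ t → 2 * (q * t) + suc n * e) (∑-splitPairs-∷ U x l) ⟨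
      2 * (q * ∑ U (λ y → splitPairs y (x ∷ l))) + suc n * e ∎
      where
      open ≤-Reasoning
      n = length l
      P = ∑ U (λ y → splitPairs y l)
      S = ∑ l (separation U x)
      square : ∀ n e → suc n * suc n * e ≡ n * n * e + (2 * (n * e) + e)
      square = solve-∀
      collect : ∀ q P S n e → (2 * (q * P) + n * e) + (2 * (q * S) + e) ≡ 2 * (q * (P + S)) + suc n * e
      collect = solve-∀

    -- This is `splitPairs-far` divided by `length l`, by means of `*≤+*⊓`. The factor
    -- `1 ⊓ length l` makes an empty class contribute nothing, so that summing over classes produces
    -- `#traces`.
    ∑-minSide : ∀ {l} → AllPairs Far l →
                length l * e ≤ 2 * (q * ∑ U (λ y → minSide y l)) + (1 ⊓ length l) * e
    ∑-minSide {[]}         _    = z≤n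
    ∑-minSide {l@(_ ∷ _)} fars = *-cancelˡ-≤ n (begin
      n * (n * e)                                            ≡⟨ *-assoc n n e ⟨
      n * n * e                                              ≤⟨ splitPairs-far fars ⟩
      2 * (q * ∑ U (λ y → splitPairs y l)) + n * e           ≤⟨ +-monoˡ-≤ (n * e) (*-monoʳ-≤ 2 (*-monoʳ-≤ q P≤)) ⟩
      2 * (q * (n * ∑ U (λ y → minSide y l))) + n * e        ≡⟨ factor q n (∑ U (λ y → minSide y l)) e ⟩
      n * (2 * (q * ∑ U (λ y → minSide y l)) + 1 * e) ∎)
      where
      open ≤-Reasoning
      n = length l
      P≤ : ∑ U (λ y → splitPairs y l) ≤ n * ∑ U (λ y → minSide y l)
      P≤ = ≤-trans (∑-mono U (λ y → subst (λ t → splitPairs y l ≤ t * minSide y l) (length-side y l)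
                     (*≤+*⊓ (length (side y false l)) (length (side y true l)))))
                   (≤-reflexive (∑-* U n (λ y → minSide y l)))
      factor : ∀ q n s e → 2 * (q * (n * s)) + n * e ≡ n * (2 * (q * s) + 1 * e)
      factor = solve-∀

  module _ (U : List Y) (q k : ℕ) where

    private
      N = length U

    -- The weight of the cube edges in the direction of `y`, for the sample `y ∷ ys`.
    crossing : Y → List V → Vec Y r → ℕ
    crossing {r} y l ys = ∑ (cube r) (λ f → weight (side y false l) ys f ⊓ weight (side y true l) ys f)

    -- `∑-minSide` applies within every class of `ys`; the class sizes add up to `length l` and the
    -- correction terms to `#traces l ys`, which `#traces-mono` raises to the count for the full
    -- sample.
    ∑-crossing : ∀ {l} → AllPairs (Far U q (N * k)) l → ∀ (ys : Vec Y r) →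
      ∑ U (λ _ → k * length l) ≤ ∑ U (λ y → 2 * (q * crossing y l ys) + k * #traces l (y ∷ ys))
    ∑-crossing {r} {l} fars ys = begin
      ∑ U (λ _ → k * length l)                                             ≡⟨ ∑-const U (k * length l) ⟩
      N * (k * length l)                                                   ≡⟨ *-assoc N k (length l) ⟨
      N * k * length l                                                     ≡⟨ cong (N * k *_) (∑-weight l ys) ⟨
      N * k * ∑ (cube r) (weight l ys)                                     ≡⟨ ∑-* (cube r) (N * k) (weight l ys) ⟨
      ∑ (cube r) (λ f → N * k * weight l ys f)
        ≤⟨ ∑-mono (cube r) (λ f → ≤-trans (≤-reflexive (*-comm (N * k) (weight l ys f)))
             (∑-minSide U q (N * k) (class-AllPairs ys f fars))) ⟩
      ∑ (cube r) (λ f → 2 * (q * ∑ U (λ y → minSide y (class l ys f))) + (1 ⊓ weight l ys f) * (N * k))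
        ≡⟨ ∑-+ (cube r) _ _ ⟩
      ∑ (cube r) (λ f → 2 * (q * ∑ U (λ y → minSide y (class l ys f))))
        + ∑ (cube r) (λ f → (1 ⊓ weight l ys f) * (N * k))
        ≡⟨ cong₂ _+_ left right ⟩
      ∑ U (λ y → 2 * (q * crossing y l ys)) + ∑ U (λ _ → k * #traces l ys)
        ≤⟨ +-monoʳ-≤ _ (∑-mono U (λ y → *-monoʳ-≤ k (#traces-mono y l ys))) ⟩
      ∑ U (λ y → 2 * (q * crossing y l ys)) + ∑ U (λ y → k * #traces l (y ∷ ys))
        ≡⟨ ∑-+ U _ _ ⟨
      ∑ U (λ y → 2 * (q * crossing y l ys) + k * #traces l (y ∷ ys)) ∎
      where
      open ≤-Reasoning
      ∑-2q : ∀ {A : Set} (xs : List A) f → ∑ xs (λ x → 2 * (q * f x)) ≡ 2 * (q * ∑ xs f)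
      ∑-2q xs f = ≡.trans (∑-* xs 2 _) (cong (2 *_) (∑-* xs q f))
      left : ∑ (cube r) (λ f → 2 * (q * ∑ U (λ y → minSide y (class l ys f))))
             ≡ ∑ U (λ y → 2 * (q * crossing y l ys))
      left = ≡.trans (∑-2q (cube r) _) (≡.trans (cong (λ t → 2 * (q * t)) (≡.trans (∑-comm (cube r) U _)
               (∑-cong U λ y → ∑-cong (cube r) λ f → ≡.sym
                 (cong₂ (λ a b → length a ⊓ length b) (class-side y false l ys f) (class-side y true l ys f)))))
               (≡.sym (∑-2q U _)))
      right : ∑ (cube r) (λ f → (1 ⊓ weight l ys f) * (N * k)) ≡ ∑ U (λ _ → k * #traces l ys)
      right = ≡.trans (∑-cong (cube r) (λ f → *-comm (1 ⊓ weight l ys f) (N * k)))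
              (≡.trans (∑-* (cube r) (N * k) _)
              (≡.trans (*-assoc N k (#traces l ys)) (≡.sym (∑-const U (k * #traces l ys)))))

    -- Haussler's averaging argument: along each of the r coordinates, a random
    -- sample point splits the classes cut out by the other ones, because any
    -- two elements of l are separated by a k/q fraction of U.
    ∑-edges : ∀ r {l} → AllPairs (Far U q (N * k)) l →
      ∑ (tuples U r) (λ _ → k * r * length l) ≤
      ∑ (tuples U r) (λ ys → 2 * (q * edges r (weight l ys)) + k * r * #traces l ys)
    ∑-edges zero    {l} fars = ≤-trans (≤-reflexive (cong (λ t → t * length l + 0) (*-zeroʳ k))) z≤n
    ∑-edges (suc r) {l} fars = begin
      ∑ (tuples U (suc r)) (λ _ → k * suc r * length l)
        ≡⟨ ∑-tuples U _ ⟩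
      ∑ U (λ y → ∑ Ts (λ _ → k * suc r * length l))
        ≡⟨ ∑-cong U (λ y → ∑-cong Ts (λ ys → expand y)) ⟩
      ∑ U (λ y → ∑ Ts (λ ys → k * r * length (side y false l) + k * r * length (side y true l) + k * length l))
        ≡⟨ ∑-cong U (λ y → ∑-+₃ Ts _ _ _) ⟩
      ∑ U (λ y → ∑ Ts (λ _ → k * r * length (side y false l)) + ∑ Ts (λ _ → k * r * length (side y true l))
                 + ∑ Ts (λ _ → k * length l))
        ≡⟨ ∑-+ U _ _ ⟩
      ∑ U (λ y → ∑ Ts (λ _ → k * r * length (side y false l)) + ∑ Ts (λ _ → k * r * length (side y true l)))
        + ∑ U (λ y → ∑ Ts (λ _ → k * length l))
        ≤⟨ +-mono-≤ (∑-mono U (λ y → +-mono-≤ (∑-edges r (side-AllPairs y false fars))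
                                              (∑-edges r (side-AllPairs y true fars)))) first ⟩
      ∑ U (λ y → ∑ Ts (b false y) + ∑ Ts (b true y)) + ∑ U (λ y → ∑ Ts (c y))
        ≡⟨ ∑-+ U _ _ ⟨
      ∑ U (λ y → ∑ Ts (b false y) + ∑ Ts (b true y) + ∑ Ts (c y))
        ≡⟨ ∑-cong U (λ y → ∑-+₃ Ts _ _ _) ⟨
      ∑ U (λ y → ∑ Ts (λ ys → b false y ys + b true y ys + c y ys))
        ≡⟨ ∑-cong U (λ y → ∑-cong Ts (combine y)) ⟩
      ∑ U (λ y → ∑ Ts (λ ys → 2 * (q * edges (suc r) (weight l (y ∷ ys))) + k * suc r * #traces l (y ∷ ys)))
        ≡⟨ ∑-tuples U _ ⟨
      ∑ (tuples U (suc r)) (λ ys → 2 * (q * edges (suc r) (weight l ys)) + k * suc r * #traces l ys) ∎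
      where
      open ≤-Reasoning
      Ts = tuples U r
      b : Bool → Y → Vec Y r → ℕ
      b s y ys = 2 * (q * edges r (weight (side y s l) ys)) + k * r * #traces (side y s l) ys
      c : Y → Vec Y r → ℕ
      c y ys = 2 * (q * crossing y l ys) + k * #traces l (y ∷ ys)
      ∑-+₃ : ∀ {A : Set} (xs : List A) f g h → ∑ xs (λ x → f x + g x + h x) ≡ ∑ xs f + ∑ xs g + ∑ xs h
      ∑-+₃ xs f g h = ≡.trans (∑-+ xs _ h) (cong (_+ ∑ xs h) (∑-+ xs f g))
      expand : ∀ y → k * suc r * length l ≡
                     k * r * length (side y false l) + k * r * length (side y true l) + k * length l
      expand y = ≡.trans (cong (k * suc r *_) (≡.sym (length-side y l)))
        (≡.trans (distribute k r (length (side y false l)) (length (side y true l)))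
          (cong (λ t → k * r * length (side y false l) + k * r * length (side y true l) + k * t) (length-side y l)))
        where
        distribute : ∀ k r a b → k * suc r * (a + b) ≡ k * r * a + k * r * b + k * (a + b)
        distribute = solve-∀
      -- The rest `ys` of the sample is held fixed while `y` ranges over `U`, hence the exchange of
      -- the two sums.
      first : ∑ U (λ y → ∑ Ts (λ _ → k * length l)) ≤ ∑ U (λ y → ∑ Ts (c y))
      first = subst₂ _≤_ (≡.sym (∑-comm U Ts _)) (≡.sym (∑-comm U Ts c)) (∑-mono Ts (∑-crossing fars))
      combine : ∀ y ys → b false y ys + b true y ys + c y ys ≡
                2 * (q * edges (suc r) (weight l (y ∷ ys))) + k * suc r * #traces l (y ∷ ys)
      combine y ys rewrite ∑-cube (λ f → 1 ⊓ weight l (y ∷ ys) f) =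
        collect q k r (edges r (weight (side y false l) ys)) (edges r (weight (side y true l) ys))
          (crossing y l ys) (#traces (side y false l) ys) (#traces (side y true l) ys)
        where
        collect : ∀ q k r e₀ e₁ x t₀ t₁ →
          (2 * (q * e₀) + k * r * t₀) + (2 * (q * e₁) + k * r * t₁) + (2 * (q * x) + k * (t₀ + t₁)) ≡
          2 * (q * (e₀ + e₁ + x)) + k * suc r * (t₀ + t₁)
        collect = solve-∀

cube-unique : ∀ r → AllPairs _≢_ (cube r)
cube-unique zero    = [] ∷ []
cube-unique (suc r) = AllPairs.++⁺ (half false) (half true)
  (All.map⁺ (All.universal (λ _ → All.map⁺ (All.universal (λ _ ()) (cube r))) (cube r)))
  where
  half : ∀ b → AllPairs _≢_ (map (b ∷_) (cube r))
  half b = AllPairs.map⁺ (AllPairs.map (λ f≢g eq → f≢g (∷-injectiveʳ eq)) (cube-unique r))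

length-cube : ∀ r → length (cube r) ≡ 2 ^ r
length-cube zero    = refl
length-cube (suc r) = ≡.trans (length-++ (map (false ∷_) (cube r)))
  (cong₂ _+_ (≡.trans (length-map (false ∷_) (cube r)) (length-cube r))
             (≡.trans (length-map (true ∷_) (cube r)) (≡.trans (length-cube r) (≡.sym (+-identityʳ _)))))

∑-const≰∑ : ∀ (xs : List A) {c} {f : A → ℕ} → (∀ x → f x < c) → 0 < length xs →
            ∑ xs (λ _ → c) ≤ ∑ xs f → ⊥
∑-const≰∑ xs {c} {f} f<c xs>0 c≤f = n≮n (∑ xs f) (begin
  1 + ∑ xs f               ≤⟨ +-monoˡ-≤ (∑ xs f) xs>0 ⟩
  length xs + ∑ xs f       ≡⟨ cong (_+ ∑ xs f) (≡.trans (∑-const xs 1) (*-identityʳ _)) ⟨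
  ∑ xs (λ _ → 1) + ∑ xs f  ≡⟨ ∑-+ xs (λ _ → 1) f ⟨
  ∑ xs (suc ∘ f)           ≤⟨ ∑-mono xs f<c ⟩
  ∑ xs (λ _ → c)           ≤⟨ c≤f ⟩
  ∑ xs f ∎)
  where open ≤-Reasoning

tuples-nonempty : ∀ (U : List A) r → 0 < length U → 0 < length (tuples U r)
tuples-nonempty U zero    U>0 = s≤s z≤n
tuples-nonempty (u ∷ U) (suc r) U>0 = begin
  1                                                           ≤⟨ tuples-nonempty (u ∷ U) r U>0 ⟩
  length (tuples (u ∷ U) r)                                   ≡⟨ length-map (u ∷_) (tuples (u ∷ U) r) ⟨
  length (map (u ∷_) (tuples (u ∷ U) r))                      ≤⟨ m≤m+n _ _ ⟩
  length (map (u ∷_) (tuples (u ∷ U) r)) + length rest        ≡⟨ length-++ (map (u ∷_) (tuples (u ∷ U) r)) ⟨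
  length (tuples (u ∷ U) (suc r)) ∎
  where
  open ≤-Reasoning
  rest = concatMap (λ y → map (y ∷_) (tuples (u ∷ U) r)) U

module Packing {Y V : Set} (h : Y → V → Bool) where
  open Traces h

  trace : Vec Y r → V → Vec Bool r
  trace ys x = Vec.map (λ y → h y x) ys

  DistinctTraces : Vec Y r → List V → Set
  DistinctTraces ys = AllPairs (_≢_ on trace ys)

  ∈-side⁻ : ∀ y b l {x} → x ∈ side y b l → x ∈ l × h y x ≡ b
  ∈-side⁻ y b l {x} x∈ with b | h y x in eq
  ... | false | false = proj₁ (∈-filter⁻ (T? ∘ not ∘ h y) {xs = l} x∈) , refl
  ... | true  | true  = proj₁ (∈-filter⁻ (T? ∘ h y) {xs = l} x∈) , refl
  ... | false | true  = contradiction (proj₂ (∈-filter⁻ (T? ∘ not ∘ h y) {xs = l} x∈))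
                          (subst (λ b → T (not b) → ⊥) (≡.sym eq) (λ ()))
  ... | true  | false = contradiction (proj₂ (∈-filter⁻ (T? ∘ h y) {xs = l} x∈))
                          (subst (λ b → T b → ⊥) (≡.sym eq) (λ ()))

  -- One element is taken from each nonempty class; those from different sides of `y` differ in the
  -- first bit of the trace.
  representatives : ∀ l (ys : Vec Y r) →
    ∃[ B ] DistinctTraces ys B × All (_∈ l) B × length B ≡ #traces l ys
  representatives []      [] = [] , [] , [] , refl
  representatives (x ∷ l) [] = x ∷ [] , [] ∷ [] , here refl ∷ [] , refl
  representatives l (y ∷ ys)
    with representatives (side y false l) ys | representatives (side y true l) ys
  ... | B₀ , dt₀ , ∈₀ , len₀ | B₁ , dt₁ , ∈₁ , len₁ =
    B₀ ++ B₁ ,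
    AllPairs.++⁺ (AllPairs.map (λ ne eq → ne (∷-injectiveʳ eq)) dt₀)
                 (AllPairs.map (λ ne eq → ne (∷-injectiveʳ eq)) dt₁)
      (All.map (λ x∈ → All.map (λ x′∈ → differ x∈ x′∈) ∈₁) ∈₀) ,
    All.++⁺ (All.map (proj₁ ∘ ∈-side⁻ y false l) ∈₀) (All.map (proj₁ ∘ ∈-side⁻ y true l) ∈₁) ,
    ≡.trans (length-++ B₀) (≡.trans (cong₂ _+_ len₀ len₁) (≡.sym (∑-cube (λ f → 1 ⊓ weight l (y ∷ ys) f))))
    where
    differ : ∀ {x x′} → x ∈ side y false l → x′ ∈ side y true l → trace (y ∷ ys) x ≢ trace (y ∷ ys) x′
    differ x∈ x′∈ eq with ≡.trans (≡.sym (proj₂ (∈-side⁻ y false l x∈)))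
                                  (≡.trans (∷-injectiveˡ eq) (proj₂ (∈-side⁻ y true l x′∈)))
    ... | ()

  weight>0⇒trace : ∀ l (ys : Vec Y r) f → 0 < weight l ys f → ∃[ x ] x ∈ l × trace ys x ≡ f
  weight>0⇒trace []      [] [] ()
  weight>0⇒trace (x ∷ l) [] [] _ = x , here refl , refl
  weight>0⇒trace l (y ∷ ys) (b ∷ f) w>0 with weight>0⇒trace (side y b l) ys f w>0
  ... | x , x∈ , eq = x , proj₁ (∈-side⁻ y b l x∈) , cong₂ _∷_ (proj₂ (∈-side⁻ y b l x∈)) eq

  -- Restricting the sample to the shattered coordinates gives one element per pattern. Hence a
  -- bound on the number of distinct traces also bounds the dimension.
  shatters⇒traces : ∀ {d} l (ys : Vec Y r) → Shatters d (weight l ys) →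
    ∃[ zs ] ∃[ B ] DistinctTraces {d} zs B × length B ≡ 2 ^ d
  shatters⇒traces {d = d} l ys (I , sh) =
    Vec.map (lookup ys) I , map vertex (cube d) ,
    AllPairs.map⁺ (AllPairs.map
      (λ {p} {p′} p≢p′ eq → p≢p′ (≡.trans (≡.sym (vertex-trace p)) (≡.trans eq (vertex-trace p′))))
      (cube-unique d)) ,
    ≡.trans (length-map vertex (cube d)) (length-cube d)
    where
    witness : ∀ p → ∃[ x ] x ∈ l × trace ys x ≡ proj₁ (sh p)
    witness p = weight>0⇒trace l ys (proj₁ (sh p)) (proj₁ (proj₂ (sh p)))
    vertex : Vec Bool d → V
    vertex p = proj₁ (witness p)
    vertex-trace : ∀ p → trace (Vec.map (lookup ys) I) (vertex p) ≡ p
    vertex-trace p = begin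
      Vec.map (λ y → h y (vertex p)) (Vec.map (lookup ys) I)  ≡⟨ Vec.map-∘ _ _ I ⟨
      Vec.map (λ i → h (lookup ys i) (vertex p)) I            ≡⟨ Vec.map-cong (λ i → ≡.sym (lookup-map i _ ys)) I ⟩
      Vec.map (lookup (trace ys (vertex p))) I
        ≡⟨ cong (λ t → Vec.map (lookup t) I) (proj₂ (proj₂ (witness p))) ⟩
      Vec.map (lookup (proj₁ (sh p))) I                       ≡⟨ proj₂ (proj₂ (sh p)) ⟩
      p ∎
      where open ≡.≡-Reasoning

  -- Let `m = length l`. In every sample the dimension allows at most `d * m` edges, and `growth` at
  -- most `m / 2` traces. As `4 * d * m < k * r`, the edge term of `∑-edges` is below half of
  -- `k * r * m` and the trace term at most half, so their average cannot reach `k * r * m`.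
  packing : ∀ (U : List Y) (l : List V) d k r → 0 < length U → 0 < length l →
    (∀ (ys : Vec Y d) B → DistinctTraces ys B → length B < 2 ^ d) →
    (∀ (ys : Vec Y r) B → DistinctTraces ys B → 2 * length B ≤ length l) →
    4 * d * length l < k * r →
    AllPairs (Far U (length l) (length U * k)) l → ⊥
  packing U l d k r U>0 l>0 dim growth 4dm<kr fars =
    ∑-const≰∑ (tuples U r) bound (tuples-nonempty U r U>0) (∑-edges U m k r fars)
    where
    m = length l
    edges≤ : ∀ ys → edges r (weight l ys) ≤ d * m
    edges≤ ys with edges-bound r d (weight l ys)
    ... | inj₁ e  = ≤-trans (m≤m+n _ _) (≤-trans e (≤-reflexive (cong (d *_) (∑-weight l ys))))
    ... | inj₂ sh with shatters⇒traces l ys sh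
    ...   | zs , B , dt , len = contradiction (dim zs B dt) (<-irrefl len)
    traces≤ : ∀ ys → 2 * #traces l ys ≤ m
    traces≤ ys with representatives l ys
    ... | B , dt , _ , len = subst (λ t → 2 * t ≤ m) len (growth ys B dt)
    bound : ∀ ys → 2 * (m * edges r (weight l ys)) + k * r * #traces l ys < k * r * m
    bound ys = *-cancelˡ-< 2 _ _ (begin-strict
      2 * (2 * (m * e) + k * r * t)       ≡⟨ double m e (k * r) t ⟩
      4 * (m * e) + k * r * (2 * t)
        ≤⟨ +-mono-≤ (*-monoʳ-≤ 4 (*-monoʳ-≤ m (edges≤ ys))) (*-monoʳ-≤ (k * r) (traces≤ ys)) ⟩
      4 * (m * (d * m)) + k * r * m       ≡⟨ cong (_+ k * r * m) (reassoc m d) ⟩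
      4 * d * m * m + k * r * m           <⟨ +-monoˡ-< (k * r * m) (*-monoˡ-< m {{>-nonZero l>0}} 4dm<kr) ⟩
      k * r * m + k * r * m               ≡⟨ cong (k * r * m +_) (+-identityʳ (k * r * m)) ⟨
      2 * (k * r * m) ∎)
      where
      open ≤-Reasoning
      e = edges r (weight l ys)
      t = #traces l ys
      double : ∀ m e s t → 2 * (2 * (m * e) + s * t) ≡ 4 * (m * e) + s * (2 * t)
      double = solve-∀
      reassoc : ∀ m d → 4 * (m * (d * m)) ≡ 4 * d * m * m
      reassoc = solve-∀

-- Counting labelled graphs

lookup-injective : ∀ {A : Set} {xs : List A} → Unique xs → Injective _≡_ _≡_ (List.lookup xs)
lookup-injective (x∉ ∷ xs!) {zero}  {zero}  eq = refl
lookup-injective {xs = x ∷ xs} (x∉ ∷ xs!) {zero}  {suc j} eq = contradiction eq (All.lookup x∉ (∈-lookup j))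
lookup-injective {xs = x ∷ xs} (x∉ ∷ xs!) {suc i} {zero}  eq = contradiction (≡.sym eq) (All.lookup x∉ (∈-lookup i))
lookup-injective (x∉ ∷ xs!) {suc i} {suc j} eq = cong suc (lookup-injective xs! eq)

unique-length : ∀ {n} {xs : List (Fin n)} → Unique xs → length xs ≤ n
unique-length xs! = Fin.injective⇒≤ (lookup-injective xs!)

module _ {n : ℕ} where

  _∖_ : List (Fin n) → Fin n → List (Fin n)
  B ∖ x = filter (λ y → ¬? (x Fin.≟ y)) B

  length-∖ : ∀ {B} x → Unique B → length B ≤ suc (length (B ∖ x))
  length-∖ x []                  = z≤n
  length-∖ {y ∷ B} x (y∉ ∷ B!) with x Fin.≟ y
  ... | yes refl = s≤s (≤-reflexive (cong length (≡.sym (filter-all (λ y → ¬? (x Fin.≟ y)) y∉))))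
  ... | no _     = s≤s (length-∖ x B!)

  _∖∖_ : List (Fin n) → List (Fin n) → List (Fin n)
  B ∖∖ []      = B
  B ∖∖ (x ∷ D) = (B ∖∖ D) ∖ x

  ∖∖-AllPairs : ∀ {R : Fin n → Fin n → Set} {B} D → AllPairs R B → AllPairs R (B ∖∖ D)
  ∖∖-AllPairs []      RB = RB
  ∖∖-AllPairs (x ∷ D) RB = AllPairs.filter⁺ _ (∖∖-AllPairs D RB)

  ∖∖-fresh : ∀ B D → All (_∉ D) (B ∖∖ D)
  ∖∖-fresh B []      = All.universal (λ _ ()) B
  ∖∖-fresh B (x ∷ D) = All.zipWith
    (λ { (x≢y , y∉D) (here y≡x) → x≢y (≡.sym y≡x) ; (x≢y , y∉D) (there y∈D) → y∉D y∈D })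
    (All.all-filter (λ y → ¬? (x Fin.≟ y)) (B ∖∖ D) , All.filter⁺ (λ y → ¬? (x Fin.≟ y)) (∖∖-fresh B D))

  length-∖∖ : ∀ {B} D → Unique B → length B ≤ length D + length (B ∖∖ D)
  length-∖∖ []      B! = ≤-refl
  length-∖∖ {B} (x ∷ D) B! = ≤-trans (length-∖∖ D B!)
    (≤-trans (+-monoʳ-≤ (length D) (length-∖ x (∖∖-AllPairs D B!))) (≤-reflexive (+-suc (length D) _)))

length-concatMap : ∀ {A B : Set} s (g : A → List B) {xs} → All (λ x → s ≤ length (g x)) xs →
                   s * length xs ≤ length (concatMap g xs)
length-concatMap s g []              = ≤-reflexive (*-zeroʳ s)
length-concatMap s g {x ∷ xs} (p ∷ ps) = begin
  s * suc (length xs)                      ≡⟨ *-suc s (length xs) ⟩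
  s + s * length xs                        ≤⟨ +-mono-≤ p (length-concatMap s g ps) ⟩
  length (g x) + length (concatMap g xs)   ≡⟨ length-++ (g x) ⟨
  length (concatMap g (x ∷ xs)) ∎
  where open ≤-Reasoning

-- It computes to `induce` but takes the bare map, so the graph of an embedding can be formed before
-- the embedding is shown to be injective.
pullback : ∀ {m n} → (Fin m → Fin n) → Graph n → Graph m
pullback f G = record
  { adj    = λ i j → adj G (f i) (f j)
  ; sym    = λ i j → sym G (f i) (f j)
  ; irrefl = λ i → irrefl G (f i)
  }

-- Every injective sequence of M elements of B, placed before a fixed labelling
-- of A, induces a labelled graph; distinct sequences give distinct graphs
-- because the elements of B have distinct traces on A.
module Extensions {n k : ℕ} (G : Graph n) (A : Fin k → Fin n) where

  Differ : Fin n → Fin n → Set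
  Differ x y = ∃[ j ] adj G (A j) x ≢ adj G (A j) y

  -- An embedding together with the elements of B that it has not yet used.
  Embedding : ℕ → Set
  Embedding M = (Fin (M + k) → Fin n) × List (Fin n)

  record Valid (total : ℕ) {M : ℕ} (e : Embedding M) : Set where
    field
      injective : Injective _≡_ _≡_ (proj₁ e)
      covers    : ∀ j → ∃[ i ] proj₁ e i ≡ A j
      fresh     : All (λ x → ∀ i → x ≢ proj₁ e i) (proj₂ e)
      differ    : AllPairs Differ (proj₂ e)
      unused    : total ≤ M + length (proj₂ e)
  open Valid

  prepend : ∀ {M} → Fin n → (Fin (M + k) → Fin n) → Fin (suc M + k) → Fin n
  prepend x f zero    = x
  prepend x f (suc i) = f i

  extend : ∀ {M} → Embedding M → List (Embedding (suc M))
  extend (f , B) = map (λ x → prepend x f , B ∖ x) B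

  extensions : List (Fin n) → ∀ M → List (Embedding M)
  extensions B zero    = (A , B) ∷ []
  extensions B (suc M) = concatMap extend (extensions B M)

  Differ⇒≢ : ∀ {x y} → Differ x y → x ≢ y
  Differ⇒≢ (j , ne) refl = ne refl

  extend-valid : ∀ {total M} {e : Embedding M} → Valid total e → All (Valid total) (extend e)
  extend-valid {total} {M} {f , B} v = All.map⁺ (All.map valid (fresh v))
    where
    valid : ∀ {x} → (∀ i → x ≢ f i) → Valid total (prepend x f , B ∖ x)
    valid {x} x∉f = record
      { injective = inj
      ; covers    = λ j → let i , eq = covers v j in suc i , eq
      ; fresh     = All.zipWith (λ { (x≢y , y∉f) zero → x≢y ∘ ≡.sym ; (x≢y , y∉f) (suc i) → y∉f i })
                      (All.all-filter (λ y → ¬? (x Fin.≟ y)) B , All.filter⁺ (λ y → ¬? (x Fin.≟ y)) (fresh v))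
      ; differ    = AllPairs.filter⁺ (λ y → ¬? (x Fin.≟ y)) (differ v)
      ; unused    = ≤-trans (unused v) (≤-trans (+-monoʳ-≤ M (length-∖ x (AllPairs.map Differ⇒≢ (differ v))))
                      (≤-reflexive (+-suc M _)))
      }
      where
      inj : Injective _≡_ _≡_ (prepend x f)
      inj {zero}  {zero}  eq = refl
      inj {zero}  {suc j} eq = contradiction eq (x∉f j)
      inj {suc i} {zero}  eq = contradiction (≡.sym eq) (x∉f i)
      inj {suc i} {suc j} eq = cong suc (injective v eq)

  extensions-valid : ∀ {total B} M → Valid total (A , B) → All (Valid total) (extensions B M)
  extensions-valid zero    v = v ∷ []
  extensions-valid (suc M) v = All.concat⁺ (All.map⁺ (All.map extend-valid (extensions-valid M v)))

  graph : ∀ {M} → Embedding M → Graph (M + k)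
  graph (f , _) = pullback f G

  -- Two candidates see some `A j` differently, and `A j` has the same position in both graphs.
  extend-distinct : ∀ {total M} {e : Embedding M} → Valid total e → AllPairs (Distinct on graph) (extend e)
  extend-distinct {e = f , B} v = AllPairs.map⁺ (AllPairs.map distinct (differ v))
    where
    distinct : ∀ {x y} → Differ x y → Distinct (pullback (prepend x f) G) (pullback (prepend y f) G)
    distinct {x} {y} (j , ne) with covers v j
    ... | i , eq = suc i , zero , subst (λ a → adj G a x ≢ adj G a y) (≡.sym eq) ne

  -- Extensions of the same embedding differ by `extend-distinct`; graphs that differ already still
  -- do so, at positions shifted by one.
  extensions-distinct : ∀ {total B} M → Valid total (A , B) → AllPairs (Distinct on graph) (extensions B M)
  extensions-distinct zero    v = [] ∷ []
  extensions-distinct (suc M) v = AllPairs.concat⁺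
    (All.map⁺ (All.map extend-distinct (extensions-valid M v)))
    (AllPairs.map⁺ (AllPairs.map
      (λ { {_ , B} {_ , B′} (i , j , ne) →
           All.map⁺ (All.universal (λ _ → All.map⁺ (All.universal (λ _ → suc i , suc j , ne) B′)) B) })
      (extensions-distinct M v)))

  -- Before each of the first `M` choices fewer than `M` of the `s + M` elements are used, so at
  -- least `s` are available.
  length-extensions : ∀ {s B} M j → j ≤ M → Valid (s + M) (A , B) → s ^ j ≤ length (extensions B j)
  length-extensions M zero    j≤M v = ≤-refl
  length-extensions {s} {B} M (suc j) j<M v =
    ≤-trans (*-monoʳ-≤ s (length-extensions M j (<⇒≤ j<M) v))
            (length-concatMap s extend (All.map many (extensions-valid j v)))
    where
    many : ∀ {e : Embedding j} → Valid (s + M) e → s ≤ length (extend e)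
    many {f , C} w = subst (s ≤_) (≡.sym (length-map _ C))
      (+-cancelʳ-≤ j s (length C) (≤-trans (+-monoʳ-≤ s (<⇒≤ j<M)) (≤-trans (unused w) (≤-reflexive (+-comm j _)))))

-- Trace bounds from smallness

m!≤b^m : ∀ {m b} → m ≤ b → m ! ≤ b ^ m
m!≤b^m {zero}  m≤b = ≤-refl
m!≤b^m {suc m} m<b = *-mono-≤ m<b (m!≤b^m (<⇒≤ m<b))

^-distribʳ-* : ∀ a b m → (a * b) ^ m ≡ a ^ m * b ^ m
^-distribʳ-* a b zero    = refl
^-distribʳ-* a b (suc m) = ≡.trans (cong (a * b *_) (^-distribʳ-* a b m)) (swap a b (a ^ m) (b ^ m))
  where
  swap : ∀ a b c d → a * b * (c * d) ≡ a * c * (b * d)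
  swap = solve-∀

module Growth (X : GraphProp) (hereditary : Hereditary X) (c : ℕ)
  (small : ∀ n (gs : List (Graph n)) → All (X n) gs → AllPairs Distinct gs → length gs ≤ (n !) * (c ^ n))
  {n : ℕ} (G : Graph n) (XG : X n G) where

  open Packing (adj G) using (trace; DistinctTraces)

  extensions-bound : ∀ {k} (A : Fin k → Fin n) {s B} M →
                     Extensions.Valid G A (s + M) (A , B) → s ^ M ≤ (M + k) ! * c ^ (M + k)
  extensions-bound {k} A {s} {B} M v = begin
    s ^ M                               ≤⟨ length-extensions M M ≤-refl v ⟩
    length (extensions B M)             ≡⟨ length-map graph (extensions B M) ⟨
    length (map graph (extensions B M))
      ≤⟨ small (M + k) _ (All.map⁺ (All.map member (extensions-valid M v)))
                         (AllPairs.map⁺ (extensions-distinct M v)) ⟩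
    (M + k) ! * c ^ (M + k) ∎
    where
    open Extensions G A
    open ≤-Reasoning
    member : ∀ {e : Embedding M} → Valid (s + M) e → X (M + k) (graph e)
    member {f , _} w = hereditary f (Valid.injective w) G XG

  trace-≢ : ∀ {r} (ys : Vec (Fin n) r) {x x′} → trace ys x ≢ trace ys x′ →
            ∃[ y ] y ∈ toList ys × adj G y x ≢ adj G y x′
  trace-≢ []       ne = contradiction refl ne
  trace-≢ (y ∷ ys) {x} {x′} ne with adj G y x Bool.≟ adj G y x′
  ... | no  ≢y = y , here refl , ≢y
  ... | yes ≡y with trace-≢ ys (λ eq → ne (cong₂ _∷_ ≡y eq))
  ...   | z , z∈ , ≢z = z , there z∈ , ≢z

  -- At most `r` elements of `B` lie in the sample, which leaves `s + M` for the injective sequences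
  -- of length `M`. The factorial of the smallness bound is estimated by a power.
  traces-bound : ∀ {r} .{{_ : NonZero r}} (ys : Vec (Fin n) r) {B} → DistinctTraces ys B →
                 ∀ s M → s + M + r ≤ length B → s ^ M ≤ ((M + r) * suc c) ^ (M + r)
  traces-bound {r} ys {B} dt s M B≥ = begin
    s ^ M                               ≤⟨ extensions-bound (List.lookup D) M valid ⟩
    -- Passing from `c` to `suc c` makes the base positive, so that the exponent can grow from
    -- `M + k` to `M + r` below.
    (M + k) ! * c ^ (M + k)             ≤⟨ *-mono-≤ (m!≤b^m (+-monoʳ-≤ M k≤r)) (^-monoˡ-≤ (M + k) (n≤1+n c)) ⟩
    (M + r) ^ (M + k) * suc c ^ (M + k) ≡⟨ ^-distribʳ-* (M + r) (suc c) (M + k) ⟨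
    ((M + r) * suc c) ^ (M + k)
      ≤⟨ ^-monoʳ-≤ ((M + r) * suc c) {{m*n≢0 (M + r) (suc c) {{>-nonZero M+r>0}}}} (+-monoʳ-≤ M k≤r) ⟩
    ((M + r) * suc c) ^ (M + r) ∎
    where
    open ≤-Reasoning
    -- A sample may repeat vertices, but the labelling has to be injective; distinct traces still
    -- differ at some vertex of `D`.
    D = deduplicate Fin._≟_ (toList ys)
    k = length D
    open Extensions G (List.lookup D)
    k≤r : k ≤ r
    k≤r = ≤-trans (length-deduplicate Fin._≟_ (toList ys)) (≤-reflexive (length-toList ys))
    M+r>0 : 0 < M + r
    M+r>0 = ≤-trans (>-nonZero⁻¹ r) (m≤n+m r M)
    traces⇒differ : ∀ {x y} → trace ys x ≢ trace ys y → Differ x y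
    traces⇒differ {x} {y} ne with trace-≢ ys ne
    ... | z , z∈ , ≢z = index z∈D , subst (λ z → adj G z x ≢ adj G z y) (lookup-index z∈D) ≢z
      where z∈D = ∈-deduplicate⁺ Fin._≟_ z∈
    valid : Valid (s + M) (List.lookup D , B ∖∖ D)
    valid = record
      { injective = lookup-injective (deduplicate-! Fin._≟_ (toList ys))
      ; covers    = λ j → j , refl
      ; fresh     = All.map (λ y∉D i y≡ → y∉D (subst (_∈ D) (≡.sym y≡) (∈-lookup i))) (∖∖-fresh B D)
      ; differ    = ∖∖-AllPairs D (AllPairs.map traces⇒differ dt)
      ; unused    = +-cancelˡ-≤ k _ _ (begin
          k + (s + M)            ≤⟨ +-monoˡ-≤ (s + M) k≤r ⟩
          r + (s + M)            ≡⟨ +-comm r (s + M) ⟩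
          s + M + r              ≤⟨ B≥ ⟩
          length B               ≤⟨ length-∖∖ D (AllPairs.map (λ ne eq → ne (cong (trace ys) eq)) dt) ⟩
          k + length (B ∖∖ D) ∎)
      }

-- Constants, VC dimension and close pairs

n<2^n : ∀ n → n < 2 ^ n
n<2^n zero    = s≤s z≤n
n<2^n (suc n) = +-mono-≤ (m^n>0 2 n) (≤-trans (n<2^n n) (m≤m+n (2 ^ n) 0))

-- Large enough for `2 ^ d` to exceed the quadratic expression of `dimension-large`.
dimension : ℕ → ℕ
dimension c = 4 * (4 + c)

dimension-large : ∀ c → let d = dimension c ; t = (d + d) * suc c in suc (t * t) + d + d ≤ 2 ^ d
dimension-large c = begin
  -- The summand `16 * g * c + 8 * g` completes the left side to the square of `suc t′`.
  suc (t * t) + d + d    ≤⟨ m≤m+n _ (16 * g * c + 8 * g) ⟩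
  suc (t * t) + d + d + (16 * g * c + 8 * g) ≡⟨ square g c ⟩
  suc t′ * suc t′        ≤⟨ *-mono-≤ t′< t′< ⟩
  2 ^ (g + g) * 2 ^ (g + g) ≡⟨ ^-distribˡ-+-* 2 (g + g) (g + g) ⟨
  2 ^ ((g + g) + (g + g)) ≡⟨ cong (2 ^_) (four g) ⟨
  2 ^ d ∎
  where
  open ≤-Reasoning
  g = 4 + c
  d = 4 * g
  t = (d + d) * suc c
  t′ = g * (8 * suc c)
  8c≤2^g : 8 * suc c ≤ 2 ^ g
  8c≤2^g = begin
    8 * suc c   ≤⟨ *-mono-≤ (m≤m+n 8 8) (n<2^n c) ⟩
    16 * 2 ^ c  ≡⟨ ^-distribˡ-+-* 2 4 c ⟨
    2 ^ g ∎
  t′< : suc t′ ≤ 2 ^ (g + g)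
  t′< = begin-strict
    g * (8 * suc c)  <⟨ *-monoˡ-< (8 * suc c) (n<2^n g) ⟩
    2 ^ g * (8 * suc c) ≤⟨ *-monoʳ-≤ (2 ^ g) 8c≤2^g ⟩
    2 ^ g * 2 ^ g    ≡⟨ ^-distribˡ-+-* 2 g g ⟨
    2 ^ (g + g) ∎
  four : ∀ g → 4 * g ≡ (g + g) + (g + g)
  four = solve-∀
  square : ∀ g c → suc (((4 * g + 4 * g) * suc c) * ((4 * g + 4 * g) * suc c)) + 4 * g + 4 * g
                     + (16 * g * c + 8 * g)
                   ≡ suc (g * (8 * suc c)) * suc (g * (8 * suc c))
  square = solve-∀

-- `growthExponent` gives `2 * suc c * n ≤ 2 ^ (growthExponent c * L)` once `n ≤ 2 ^ (2 *
-- L)` and `L` is positive. `growthFactor` is the constant this leaves in `traces-growth`, and the factor `4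
-- * dimension c + 1` of `pairConstant` pays for the sample size in `close-pair`.
growthExponent growthFactor pairConstant : ℕ → ℕ
growthExponent c = 2 * suc c + 2
growthFactor   c = 2 * suc c * 2 ^ growthExponent c
pairConstant   c = 2 * (growthFactor c + 2) * (4 * dimension c + 1)

module ClosePairs (X : GraphProp) (hereditary : Hereditary X) (c : ℕ)
  (small : ∀ n (gs : List (Graph n)) → All (X n) gs → AllPairs Distinct gs → length gs ≤ (n !) * (c ^ n))
  {n : ℕ} (G : Graph n) (XG : X n G) (L : ℕ) (L>0 : 0 < L) (n≤4^L : n ≤ 2 ^ (2 * L)) where

  open Growth X hereditary c small G XG
  open Traces (adj G)
  open Packing (adj G)

  private
    d = dimension c
    a = growthExponent c
    Q = growthFactor c
    K = pairConstant c

  -- If `2 ^ d` traces occurred, `dimension-large` would leave `t * t + 1` candidates for each of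
  -- `d` choices, against a count of at most `t ^ (d + d)` graphs.
  traces-dimension : ∀ (ys : Vec (Fin n) d) B → DistinctTraces ys B → length B < 2 ^ d
  traces-dimension ys B dt = ≰⇒> λ 2^d≤B → n≮n (s ^ d) (begin-strict
    s ^ d              ≤⟨ traces-bound ys dt s d (≤-trans (dimension-large c) 2^d≤B) ⟩
    t ^ (d + d)        ≡⟨ ^-distribˡ-+-* t d d ⟩
    t ^ d * t ^ d      ≡⟨ ^-distribʳ-* t t d ⟨
    (t * t) ^ d        <⟨ ^-monoˡ-< d (n<1+n (t * t)) ⟩
    s ^ d ∎)
    where
    open ≤-Reasoning
    t = (d + d) * suc c
    s = suc (t * t)

  -- For a larger `B`, make `M = r * L` choices among more than `Q * M` candidates each. Since
  -- `M ≤ n`, the base `t` is at most `2 ^ (a * L)`, so the `r` surplus factors `t` amount to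
  -- `2 ^ a` per choice, and `t * 2 ^ a` equals `Q * M`.
  traces-growth : ∀ {r} .{{_ : NonZero r}} (ys : Vec (Fin n) r) B → DistinctTraces ys B →
                  length B ≤ (Q + 2) * (r * L)
  traces-growth {r} ys B dt = ≮⇒≥ λ B> → n≮n (s ^ M) (begin-strict
    s ^ M                                          ≤⟨ traces-bound ys dt s M (≤-trans room B>) ⟩
    ((M + r) * suc c) ^ (M + r)                    ≤⟨ ^-monoˡ-≤ (M + r) base≤ ⟩
    t ^ (M + r)                                    ≡⟨ ^-distribˡ-+-* t M r ⟩
    t ^ M * t ^ r                                  ≤⟨ *-monoʳ-≤ (t ^ M) (^-monoˡ-≤ r (t≤ B>)) ⟩
    t ^ M * (2 ^ (a * L)) ^ r                      ≡⟨ cong (t ^ M *_) (^-*-assoc 2 (a * L) r) ⟩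
    t ^ M * 2 ^ (a * L * r)                        ≡⟨ cong (λ e → t ^ M * 2 ^ e) (rotate a L r) ⟩
    t ^ M * 2 ^ (a * M)                            ≡⟨ cong (t ^ M *_) (^-*-assoc 2 a M) ⟨
    t ^ M * (2 ^ a) ^ M                            ≡⟨ ^-distribʳ-* t (2 ^ a) M ⟨
    (t * 2 ^ a) ^ M                                ≡⟨ cong (_^ M) (factor (suc c) M (2 ^ a)) ⟩
    (Q * M) ^ M                                    <⟨ ^-monoˡ-< M {{>-nonZero M>0}} (n<1+n (Q * M)) ⟩
    s ^ M ∎)
    where
    open ≤-Reasoning
    M = r * L
    s = suc (Q * M)
    t = 2 * suc c * M
    r≤M : r ≤ M
    r≤M = m≤m*n r L {{>-nonZero L>0}}
    M>0 : 0 < M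
    M>0 = ≤-trans (>-nonZero⁻¹ r) r≤M
    rotate : ∀ a L r → a * L * r ≡ a * (r * L)
    rotate = solve-∀
    factor : ∀ c M z → 2 * c * M * z ≡ 2 * c * z * M
    factor = solve-∀
    room : s + M + r ≤ suc ((Q + 2) * M)
    room = ≤-trans (+-monoʳ-≤ (s + M) r≤M) (≤-reflexive (collect Q M))
      where
      collect : ∀ Q M → suc (Q * M) + M + M ≡ suc ((Q + 2) * M)
      collect = solve-∀
    base≤ : (M + r) * suc c ≤ t
    base≤ = ≤-trans (*-monoˡ-≤ (suc c) (+-monoʳ-≤ M r≤M)) (≤-reflexive (twice M (suc c)))
      where
      twice : ∀ M c → (M + M) * c ≡ 2 * c * M
      twice = solve-∀
    t≤ : (Q + 2) * M < length B → t ≤ 2 ^ (a * L)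
    t≤ B> = begin
      2 * suc c * M                         ≤⟨ *-mono-≤ (<⇒≤ (n<2^n (2 * suc c))) M≤n ⟩
      2 ^ (2 * suc c) * n                   ≤⟨ *-mono-≤ (^-monoʳ-≤ 2 (m≤m*n (2 * suc c) L {{>-nonZero L>0}})) n≤4^L ⟩
      2 ^ (2 * suc c * L) * 2 ^ (2 * L)     ≡⟨ ^-distribˡ-+-* 2 (2 * suc c * L) (2 * L) ⟨
      2 ^ (2 * suc c * L + 2 * L)           ≡⟨ cong (2 ^_) (*-distribʳ-+ L (2 * suc c) 2) ⟨
      2 ^ (a * L) ∎
      where
      M≤n : M ≤ n
      M≤n = begin
        M             ≤⟨ m≤m+n M ((Q + 1) * M) ⟩
        suc (Q + 1) * M ≡⟨ cong (_* M) (+-suc Q 1) ⟨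
        (Q + 2) * M   ≤⟨ <⇒≤ B> ⟩
        length B      ≤⟨ unique-length (AllPairs.map (λ ne eq → ne (cong (trace ys) eq)) dt) ⟩
        n ∎

  separation≤ : ∀ U x y → separation U x y ≤ length U
  separation≤ U x y = ≤-trans (∑-mono U (λ u → indicator≤1 (adj G u x xor adj G u y)))
                              (≤-reflexive (≡.trans (∑-const U 1) (*-identityʳ (length U))))
    where
    indicator≤1 : ∀ b → indicator b ≤ 1
    indicator≤1 false = z≤n
    indicator≤1 true  = ≤-refl

  -- If `length l ≤ K * L`, the assumed separation exceeds the length of `U`. Otherwise `packing`
  -- applies.
  close-pair : ∀ (U : List (Fin n)) l → 2 ≤ length l →
    AllPairs (λ x y → length U * (K * L) < length l * separation U x y) l → ⊥
  close-pair U (x ∷ []) (s≤s ())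
  close-pair U l@(x ∷ y ∷ _) m≥2 far@((far₀ ∷ _) ∷ _) with ≤-total (length l) (K * L)
  ... | inj₁ m≤k = n≮n _ (begin-strict
    length U * (K * L)           <⟨ far₀ ⟩
    length l * separation U x y  ≤⟨ *-mono-≤ m≤k (separation≤ U x y) ⟩
    K * L * length U             ≡⟨ *-comm (K * L) (length U) ⟩
    length U * (K * L) ∎)
    where open ≤-Reasoning
  ... | inj₂ k≤m = packing U l d k t U>0 (s≤s z≤n) traces-dimension small-growth 4dm<kr (AllPairs.map <⇒≤ far)
    where
    open ≤-Reasoning
    m = length l
    k = K * L
    instance
      k≢0 : NonZero k
      k≢0 = >-nonZero (*-mono-≤ (*-mono-≤ (*-mono-≤ {1} {2} (s≤s z≤n) (≤-trans (s≤s z≤n) (m≤n+m 2 Q)))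
                                          (m≤n+m 1 (4 * d))) L>0)
    -- The least sample size with `4 * d * m < k * t`; as `k ≤ m`, it also satisfies
    -- `k * t ≤ (4 * d + 1) * m`.
    t = suc (4 * d * m / k)
    U>0 : 0 < length U
    U>0 = n≢0⇒n>0 λ U≡0 → n≮0 (begin-strict
      length U * k              <⟨ far₀ ⟩
      m * separation U x y      ≤⟨ *-monoʳ-≤ m (≤-trans (separation≤ U x y) (≤-reflexive U≡0)) ⟩
      m * 0                     ≡⟨ *-zeroʳ m ⟩
      0 ∎)
    4dm<kr : 4 * d * m < k * t
    4dm<kr = begin-strict
      4 * d * m                                   ≡⟨ m≡m%n+[m/n]*n (4 * d * m) k ⟩
      4 * d * m % k + 4 * d * m / k * k           <⟨ +-monoˡ-< (4 * d * m / k * k) (m%n<n (4 * d * m) k) ⟩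
      k + 4 * d * m / k * k                       ≡⟨ *-comm t k ⟩
      k * t ∎
    kr≤ : k * t ≤ (4 * d + 1) * m
    kr≤ = begin
      k * t                      ≡⟨ *-comm k t ⟩
      k + 4 * d * m / k * k      ≤⟨ +-mono-≤ k≤m (m/n*n≤m (4 * d * m) k) ⟩
      m + 4 * d * m              ≡⟨ cong (_* m) (+-comm 1 (4 * d)) ⟩
      (4 * d + 1) * m ∎
    -- `K` is chosen so that the bound of `traces-growth`, times `2 * (4 * d + 1)`, is exactly
    -- `k * t`.
    small-growth : ∀ (ys : Vec (Fin n) t) B → DistinctTraces ys B → 2 * length B ≤ m
    small-growth ys B dt = *-cancelˡ-≤ (4 * d + 1) {{>-nonZero (m≤n+m 1 (4 * d))}} (begin
      (4 * d + 1) * (2 * length B)                ≤⟨ *-monoʳ-≤ (4 * d + 1) (*-monoʳ-≤ 2 (traces-growth ys B dt)) ⟩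
      (4 * d + 1) * (2 * ((Q + 2) * (t * L)))     ≡⟨ regroup (4 * d + 1) (Q + 2) t L ⟩
      k * t                                       ≤⟨ kr≤ ⟩
      (4 * d + 1) * m ∎)
      where
      regroup : ∀ e q r L → e * (2 * (q * (r * L))) ≡ 2 * q * e * L * r
      regroup = solve-∀

-- Alternations and intervals

alternationsFrom : Bool → Vec Bool r → ℕ
alternationsFrom b []       = 0
alternationsFrom b (c ∷ cs) = indicator (b xor c) + alternationsFrom c cs

alternations : Vec Bool r → ℕ
alternations []       = 0
alternations (b ∷ bs) = alternationsFrom b bs

shiftInterval : Interval r → Interval (suc r)
shiftInterval (a , b) = suc a , suc b

Covers : Vec Bool r → List (Interval r) → Set
Covers bs Is = ∀ p → lookup bs p ≡ true ⇔ Any (InInterval p) Is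

shift-zero : ∀ {Is : List (Interval r)} → Any (InInterval zero) (map shiftInterval Is) → ⊥
shift-zero {Is = (a , b) ∷ Is} (here (() , _))
shift-zero {Is = (a , b) ∷ Is} (there any) = shift-zero any

shift-suc⁺ : ∀ {p} {Is : List (Interval r)} →
             Any (InInterval p) Is → Any (InInterval (suc p)) (map shiftInterval Is)
shift-suc⁺ (here (a≤p , p≤b)) = here (s≤s a≤p , s≤s p≤b)
shift-suc⁺ (there any)        = there (shift-suc⁺ any)

shift-suc⁻ : ∀ {p} {Is : List (Interval r)} →
             Any (InInterval (suc p)) (map shiftInterval Is) → Any (InInterval p) Is
shift-suc⁻ {Is = (a , b) ∷ Is} (here (a≤p , p≤b)) = here (s≤s⁻¹ a≤p , s≤s⁻¹ p≤b)
shift-suc⁻ {Is = (a , b) ∷ Is} (there any)        = there (shift-suc⁻ any)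

covers-false : ∀ {bs : Vec Bool r} {Is} → Covers bs Is → Covers (false ∷ bs) (map shiftInterval Is)
covers-false cov zero    = mk⇔ (λ ()) (⊥-elim ∘ shift-zero)
covers-false cov (suc p) = mk⇔ (shift-suc⁺ ∘ Equivalence.to (cov p)) (Equivalence.from (cov p) ∘ shift-suc⁻)

covers-single : ∀ {bs : Vec Bool r} {Is} → Covers bs Is →
                Covers (true ∷ bs) ((zero , zero) ∷ map shiftInterval Is)
covers-single cov zero    = mk⇔ (λ _ → here (z≤n , z≤n)) (λ _ → refl)
covers-single cov (suc p) = mk⇔ (there ∘ shift-suc⁺ ∘ Equivalence.to (cov p))
  (λ { (here (_ , ())) ; (there any) → Equivalence.from (cov p) (shift-suc⁻ any) })

covers-grow : ∀ {bs : Vec Bool (suc r)} {e Is} → Covers bs ((zero , e) ∷ Is) →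
              Covers (true ∷ bs) ((zero , suc e) ∷ map shiftInterval Is)
covers-grow cov zero    = mk⇔ (λ _ → here (z≤n , z≤n)) (λ _ → refl)
covers-grow {bs = bs} {e} {Is} cov (suc p) = mk⇔ (to ∘ Equivalence.to (cov p)) (Equivalence.from (cov p) ∘ from)
  where
  to : Any (InInterval p) ((zero , e) ∷ Is) → Any (InInterval (suc p)) ((zero , suc e) ∷ map shiftInterval Is)
  to (here (_ , p≤e)) = here (z≤n , s≤s p≤e)
  to (there any)      = there (shift-suc⁺ any)
  from : Any (InInterval (suc p)) ((zero , suc e) ∷ map shiftInterval Is) → Any (InInterval p) ((zero , e) ∷ Is)
  from (here (_ , p≤e)) = here (z≤n , s≤s⁻¹ p≤e)
  from (there any)      = there (shift-suc⁻ any)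

mutual
  -- The initial interval is kept apart from the list, so that a further leading `true` can stretch
  -- it.
  runs-true : ∀ (bs : Vec Bool r) → ∃[ e ] ∃[ Is ]
    length Is ≤ alternationsFrom true bs × Covers (true ∷ bs) ((zero , e) ∷ Is)
  runs-true []           = zero , [] , z≤n , λ { zero → mk⇔ (λ _ → here (z≤n , z≤n)) (λ _ → refl) }
  runs-true (true ∷ bs)  with runs-true bs
  ... | e , Is , len , cov =
    suc e , map shiftInterval Is , subst (_≤ _) (≡.sym (length-map _ Is)) len , covers-grow cov
  runs-true (false ∷ bs) with runs-false bs
  ... | Is , len , cov = zero , map shiftInterval Is ,
        ≤-trans (≤-reflexive (length-map _ Is)) (m≤n⇒m≤1+n len) , covers-single cov

  runs-false : ∀ (bs : Vec Bool r) → ∃[ Is ] length Is ≤ alternationsFrom false bs × Covers (false ∷ bs) Is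
  runs-false []           = [] , z≤n , λ { zero → mk⇔ (λ ()) (λ ()) }
  runs-false (true ∷ bs)  with runs-true bs
  ... | e , Is , len , cov =
    map shiftInterval ((zero , e) ∷ Is) , s≤s (subst (_≤ _) (≡.sym (length-map _ Is)) len) , covers-false cov
  runs-false (false ∷ bs) with runs-false bs
  ... | Is , len , cov = map shiftInterval Is , subst (_≤ _) (≡.sym (length-map _ Is)) len , covers-false cov

intervals : ∀ (bs : Vec Bool r) → ∃[ Is ] length Is ≤ suc (alternations bs) × Covers bs Is
intervals []           = [] , z≤n , λ ()
intervals (true ∷ bs)  with runs-true bs
... | e , Is , len , cov = (zero , e) ∷ Is , s≤s len , cov
intervals (false ∷ bs) with runs-false bs
... | Is , len , cov = Is , m≤n⇒m≤1+n len , cov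

xor-triangle : ∀ a b c → indicator (a xor c) ≤ indicator (b xor c) + indicator (a xor b)
xor-triangle false false c     = m≤m+n _ 0
xor-triangle true  true  c     = m≤m+n _ 0
xor-triangle false true  false = z≤n
xor-triangle false true  true  = s≤s z≤n
xor-triangle true  false false = s≤s z≤n
xor-triangle true  false true  = z≤n

-- Only the first comparison involves the initial bit, and there the triangle inequality applies.
alternationsFrom-change : ∀ a b (cs : Vec Bool r) →
  alternationsFrom a cs ≤ alternationsFrom b cs + indicator (a xor b)
alternationsFrom-change a b []       = z≤n
alternationsFrom-change a b (c ∷ cs) = begin
  indicator (a xor c) + alternationsFrom c cs                        ≤⟨ +-monoˡ-≤ _ (xor-triangle a b c) ⟩
  indicator (b xor c) + indicator (a xor b) + alternationsFrom c cs
    ≡⟨ swap (indicator (b xor c)) (indicator (a xor b)) _ ⟩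
  indicator (b xor c) + alternationsFrom c cs + indicator (a xor b) ∎
  where
  open ≤-Reasoning
  swap : ∀ x y z → x + y + z ≡ x + z + y
  swap = solve-∀

-- Insertion into an order

insertAfter : ∀ {y : A} (x : A) (L : Vec A r) → y Vec.∈ L → Vec A (suc r)
insertAfter x (z ∷ L) (here _)   = z ∷ x ∷ L
insertAfter x (z ∷ L) (there y∈) = z ∷ insertAfter x L y∈

∈-insertAfter-new : ∀ {y : A} x (L : Vec A r) (y∈ : y Vec.∈ L) → x Vec.∈ insertAfter x L y∈
∈-insertAfter-new x (z ∷ L) (here _)   = there (here refl)
∈-insertAfter-new x (z ∷ L) (there y∈) = there (∈-insertAfter-new x L y∈)

∈-insertAfter-old : ∀ {y u : A} x (L : Vec A r) (y∈ : y Vec.∈ L) → u Vec.∈ L → u Vec.∈ insertAfter x L y∈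
∈-insertAfter-old x (z ∷ L) (here _)   (here u≡)  = here u≡
∈-insertAfter-old x (z ∷ L) (here _)   (there u∈) = there (there u∈)
∈-insertAfter-old x (z ∷ L) (there y∈) (here u≡)  = here u≡
∈-insertAfter-old x (z ∷ L) (there y∈) (there u∈) = there (∈-insertAfter-old x L y∈ u∈)

module _ (χ : A → Bool) where

  -- The insertion adds the comparison of `z` with `x` and makes `x` the left partner of the next
  -- one; each change costs at most one, and only if `χ` separates `x` from `z`.
  insert-here : ∀ x z (L : Vec A r) →
    indicator (χ z xor χ x) + alternationsFrom (χ x) (Vec.map χ L) ≤
    alternationsFrom (χ z) (Vec.map χ L) + 2 * indicator (χ x xor χ z)
  insert-here x z L = begin
    indicator (χ z xor χ x) + alternationsFrom (χ x) (Vec.map χ L)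
      ≤⟨ +-mono-≤ (≤-reflexive (cong indicator (Bool.xor-comm (χ z) (χ x))))
                  (alternationsFrom-change (χ x) (χ z) (Vec.map χ L)) ⟩
    i + (alternationsFrom (χ z) (Vec.map χ L) + i)
      ≡⟨ collect i (alternationsFrom (χ z) (Vec.map χ L)) ⟩
    alternationsFrom (χ z) (Vec.map χ L) + 2 * i ∎
    where
    open ≤-Reasoning
    i = indicator (χ x xor χ z)
    collect : ∀ i a → i + (a + i) ≡ a + 2 * i
    collect = solve-∀

  insertAfter-alternationsFrom : ∀ b {y} x (L : Vec A r) (y∈ : y Vec.∈ L) →
    alternationsFrom b (Vec.map χ (insertAfter x L y∈)) ≤
    alternationsFrom b (Vec.map χ L) + 2 * indicator (χ x xor χ y)
  insertAfter-alternationsFrom b x (z ∷ L) (here refl) =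
    ≤-trans (+-monoʳ-≤ (indicator (b xor χ z)) (insert-here x z L))
            (≤-reflexive (≡.sym (+-assoc (indicator (b xor χ z)) _ _)))
  insertAfter-alternationsFrom b x (z ∷ L) (there y∈) =
    ≤-trans (+-monoʳ-≤ (indicator (b xor χ z)) (insertAfter-alternationsFrom (χ z) x L y∈))
            (≤-reflexive (≡.sym (+-assoc (indicator (b xor χ z)) _ _)))

  insertAfter-alternations : ∀ {y} x (L : Vec A r) (y∈ : y Vec.∈ L) →
    alternations (Vec.map χ (insertAfter x L y∈)) ≤ alternations (Vec.map χ L) + 2 * indicator (χ x xor χ y)
  insertAfter-alternations x (z ∷ L) (here refl) = insert-here x z L
  insertAfter-alternations x (z ∷ L) (there y∈)  = insertAfter-alternationsFrom (χ z) x L y∈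

-- The permutation brings the violating pair to the front, where `order` can remove `x` and keep
-- `y`.
allPairs⊎violation : ∀ {R : A → A → Set} → Decidable R → ∀ l →
  AllPairs R l ⊎ (∃[ x ] ∃[ y ] ∃[ rest ] l ↭ x ∷ y ∷ rest × ¬ R x y)
allPairs⊎violation R? []      = inj₁ []
allPairs⊎violation R? (x ∷ l) with All.all? (R? x) l | allPairs⊎violation R? l
... | yes all | inj₁ pairs = inj₁ (all ∷ pairs)
... | yes all | inj₂ (a , b , rest , perm , ¬R) =
  inj₂ (a , b , x ∷ rest ,
        ↭-trans (↭-prep x perm) (↭-trans (↭-swap x a ↭-refl) (↭-prep a (↭-swap x b ↭-refl))) , ¬R)
... | no ¬all | _ with find (All.¬All⇒Any¬ (R? x) l ¬all)
...   | y , y∈l , ¬R with ∈-∃++ y∈l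
...     | before , after , refl = inj₂ (x , y , before ++ after , ↭-prep x (shift y before after) , ¬R)

-- Reweighting

-- Bernoulli's inequality 1 + k/j ≤ (1 + 1/j)^k, multiplied by j^(k+1).
bernoulli : ∀ j k → j ^ k * (j + k) ≤ j * suc j ^ k
bernoulli j zero    = ≤-reflexive (base j)
  where
  base : ∀ j → 1 * (j + 0) ≡ j * 1
  base = solve-∀
bernoulli j (suc k) = begin
  j * j ^ k * (j + suc k)                     ≤⟨ m≤m+n _ (k * j ^ k) ⟩
  j * j ^ k * (j + suc k) + k * j ^ k         ≡⟨ regroup j k (j ^ k) ⟩
  suc j * (j ^ k * (j + k))                   ≤⟨ *-monoʳ-≤ (suc j) (bernoulli j k) ⟩
  suc j * (j * suc j ^ k)                     ≡⟨ swap (suc j) j (suc j ^ k) ⟩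
  j * (suc j * suc j ^ k) ∎
  where
  open ≤-Reasoning
  regroup : ∀ j k p → j * p * (j + suc k) + k * p ≡ suc j * (p * (j + k))
  regroup = solve-∀
  swap : ∀ a b c → a * (b * c) ≡ b * (a * c)
  swap = solve-∀

-- The total weight grows by a factor of at most 1 + k/j ≤ ((j+1)/j)^k. These factors telescope,
-- whence the `k`-th power of the number of vertices in `order`.
growth-step : ∀ N s j k .{{_ : NonZero j}} → j * s ≤ N * k → (N + s) * j ^ k ≤ N * suc j ^ k
growth-step N s j k js≤Nk = *-cancelˡ-≤ j (begin
  j * ((N + s) * j ^ k)          ≡⟨ expand j N s (j ^ k) ⟩
  (N * j + j * s) * j ^ k        ≤⟨ *-monoˡ-≤ (j ^ k) (+-monoʳ-≤ (N * j) js≤Nk) ⟩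
  (N * j + N * k) * j ^ k        ≡⟨ factor N j k (j ^ k) ⟩
  N * (j ^ k * (j + k))          ≤⟨ *-monoʳ-≤ N (bernoulli j k) ⟩
  N * (j * suc j ^ k)            ≡⟨ swap N j (suc j ^ k) ⟩
  j * (N * suc j ^ k) ∎)
  where
  open ≤-Reasoning
  expand : ∀ j N s p → j * ((N + s) * p) ≡ (N * j + j * s) * p
  expand = solve-∀
  factor : ∀ N j k p → (N * j + N * k) * p ≡ N * (p * (j + k))
  factor = solve-∀
  swap : ∀ a b c → a * (b * c) ≡ b * (a * c)
  swap = solve-∀

count : ∀ {n} → Fin n → List (Fin n) → ℕ
count v U = ∑ U (λ u → indicator (does (v Fin.≟ u)))

∈⇒count>0 : ∀ {n} {v : Fin n} {U} → v ∈ U → 0 < count v U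
∈⇒count>0 {v = v} (here refl) with v Fin.≟ v
... | yes _   = s≤s z≤n
... | no v≢v  = contradiction refl v≢v
∈⇒count>0 (there v∈) = ≤-trans (∈⇒count>0 v∈) (m≤n+m _ _)

∑-filterᵇ : ∀ (p : A → Bool) U f → ∑ (filterᵇ p U) f ≡ ∑ U (λ u → indicator (p u) * f u)
∑-filterᵇ p []      f = refl
∑-filterᵇ p (u ∷ U) f with p u
... | true  = cong₂ _+_ (≡.sym (+-identityʳ (f u))) (∑-filterᵇ p U f)
... | false = ∑-filterᵇ p U f

count-filterᵇ : ∀ {n} (v : Fin n) p U → count v (filterᵇ p U) ≡ indicator (p v) * count v U
count-filterᵇ v p U = ≡.trans (∑-filterᵇ p U _) (≡.trans (∑-cong U pointwise) (∑-* U (indicator (p v)) _))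
  where
  pointwise : ∀ u → indicator (p u) * indicator (does (v Fin.≟ u)) ≡ indicator (p v) * indicator (does (v Fin.≟ u))
  pointwise u with v Fin.≟ u
  ... | yes refl = refl
  ... | no _     = ≡.trans (*-zeroʳ (indicator (p u))) (≡.sym (*-zeroʳ (indicator (p v))))

length-filterᵇ : ∀ (p : A → Bool) U → length (filterᵇ p U) ≡ ∑ U (indicator ∘ p)
length-filterᵇ p []      = refl
length-filterᵇ p (u ∷ U) with p u
... | true  = cong suc (length-filterᵇ p U)
... | false = length-filterᵇ p U

module Ordering {n : ℕ} (G : Graph n) (k : ℕ)
  (close-pair : ∀ U l → 2 ≤ length l →
    AllPairs (λ x y → length U * k < length l * Traces.separation (adj G) U x y) l → ⊥)
  where

  open Traces (adj G) using (separation)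

  splits : Fin n → Fin n → Fin n → Bool
  splits x y v = adj G v x xor adj G v y

  reweight : Fin n → Fin n → List (Fin n) → List (Fin n)
  reweight x y U = U ++ filterᵇ (splits x y) U

  length-reweight : ∀ x y U → length (reweight x y U) ≡ length U + separation U x y
  length-reweight x y U = ≡.trans (length-++ U) (cong (length U +_) (length-filterᵇ (splits x y) U))

  count-reweight : ∀ v x y U → count v (reweight x y U) ≡ count v U * 2 ^ indicator (splits x y v)
  count-reweight v x y U = ≡.trans (∑-++ U (filterᵇ (splits x y) U) _)
    (≡.trans (cong (count v U +_) (count-filterᵇ v (splits x y) U)) (double (splits x y v) (count v U)))
    where
    double : ∀ b c → c + indicator b * c ≡ c * 2 ^ indicator b
    double false c = ≡.trans (+-identityʳ c) (≡.sym (*-identityʳ c))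
    double true  c = *-comm 2 c

  -- Welzl's iterative reweighting.  The multiset U carries the weights: a
  -- vertex v is doubled each time the chosen pair x, y is split by the
  -- neighbourhood of v, so few of these pairs are split by any given v.
  order : ∀ m l → length l ≡ suc m → ∀ U →
    Σ[ L ∈ Vec (Fin n) (suc m) ] (∀ {u} → u ∈ l → u Vec.∈ L) ×
      (∀ v → ∃[ j ] alternations (Vec.map (adj G v) L) ≤ 2 * j × count v U * 2 ^ j ≤ length U * suc m ^ k)
  order zero (x ∷ []) refl U = x ∷ [] , (λ { (here u≡) → here u≡ }) , λ v → 0 , z≤n , (begin
    count v U * 1       ≤⟨ *-monoˡ-≤ 1 (count≤ v U) ⟩
    length U * 1        ≡⟨ cong (length U *_) (^-zeroˡ k) ⟨
    length U * 1 ^ k ∎)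
    where
    open ≤-Reasoning
    count≤ : ∀ v U → count v U ≤ length U
    count≤ v []      = z≤n
    count≤ v (u ∷ U) with v Fin.≟ u
    ... | yes _ = s≤s (count≤ v U)
    ... | no _  = m≤n⇒m≤1+n (count≤ v U)
  order (suc m) l len U
    with allPairs⊎violation (λ x y → length U * k <? length l * separation U x y) l
  ... | inj₁ far = ⊥-elim (close-pair U l (≤-trans (s≤s (s≤s z≤n)) (≤-reflexive (≡.sym len))) far)
  ... | inj₂ (x , y , rest , perm , ¬far)
    with order m (y ∷ rest) (suc-injective (≡.trans (≡.sym (↭-length perm)) len)) (reweight x y U)
  ...   | L , ∈L , crossings = insertAfter x L y∈L , members , crossings′
    where
    open ≤-Reasoning
    y∈L = ∈L (here refl)
    members : ∀ {u} → u ∈ l → u Vec.∈ insertAfter x L y∈L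
    members u∈ with ∈-resp-↭ perm u∈
    ... | here refl  = ∈-insertAfter-new x L y∈L
    ... | there u∈′  = ∈-insertAfter-old x L y∈L (∈L u∈′)
    -- Here `length l` is `suc (suc m)`; the smaller factor `suc m` is the `j` for which
    -- `growth-step` leads from `suc m ^ k` to `suc (suc m) ^ k`.
    close : suc m * separation U x y ≤ length U * k
    close = ≤-trans (*-monoˡ-≤ (separation U x y) (≤-trans (n≤1+n (suc m)) (≤-reflexive (≡.sym len)))) (≮⇒≥ ¬far)
    crossings′ : ∀ v → ∃[ j ] alternations (Vec.map (adj G v) (insertAfter x L y∈L)) ≤ 2 * j ×
                       count v U * 2 ^ j ≤ length U * suc (suc m) ^ k
    crossings′ v with crossings v
    -- If `v` splits the pair, then `i` is 1: the insertion adds at most two alternations, and the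
    -- reweighting has doubled `v`.
    ... | j , alt , weight≤ = j + i ,
      (begin
        alternations (Vec.map (adj G v) (insertAfter x L y∈L))  ≤⟨ insertAfter-alternations (adj G v) x L y∈L ⟩
        alternations (Vec.map (adj G v) L) + 2 * i              ≤⟨ +-monoˡ-≤ (2 * i) alt ⟩
        2 * j + 2 * i                                           ≡⟨ *-distribˡ-+ 2 j i ⟨
        2 * (j + i) ∎) ,
      (begin
        count v U * 2 ^ (j + i)                    ≡⟨ cong (λ e → count v U * 2 ^ e) (+-comm j i) ⟩
        count v U * 2 ^ (i + j)                    ≡⟨ cong (count v U *_) (^-distribˡ-+-* 2 i j) ⟩
        count v U * (2 ^ i * 2 ^ j)                ≡⟨ *-assoc (count v U) (2 ^ i) (2 ^ j) ⟨
        count v U * 2 ^ i * 2 ^ j                  ≡⟨ cong (_* 2 ^ j) (count-reweight v x y U) ⟨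
        count v (reweight x y U) * 2 ^ j           ≤⟨ weight≤ ⟩
        length (reweight x y U) * suc m ^ k        ≡⟨ cong (_* suc m ^ k) (length-reweight x y U) ⟩
        (length U + separation U x y) * suc m ^ k  ≤⟨ growth-step (length U) (separation U x y) (suc m) k close ⟩
        length U * suc (suc m) ^ k ∎)
      where i = indicator (splits x y v)

-- From the order to the contiguity bound

order⇒contiguity : ∀ {n} (G : Graph n) (L : Vec (Fin n) n) → (∀ u → u Vec.∈ L) → ∀ {k} →
  (∀ v → suc (alternations (Vec.map (adj G v) L)) ≤ k) → CtgAtMost k G
order⇒contiguity {n} G L ∈L {k} alt≤ = pos , pos-injective , neighbourhood
  where
  -- Every vertex occurs among the `n` entries of `L`, and `lookup L` recovers it from its position,
  -- so `pos` is injective.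
  pos : Fin n → Fin n
  pos u = VecAny.index (∈L u)
  lookup-pos : ∀ u → u ≡ lookup L (pos u)
  lookup-pos u = VecAny.lookup-index (∈L u)
  pos-injective : ∀ {u v} → pos u ≡ pos v → u ≡ v
  pos-injective {u} {v} eq = ≡.trans (lookup-pos u) (≡.trans (cong (lookup L) eq) (≡.sym (lookup-pos v)))
  neighbourhood : ∀ v → Σ[ Is ∈ List (Interval n) ] (length Is ≤ k) ×
                        (∀ u → (adj G v u ≡ true) ⇔ Any (InInterval (pos u)) Is)
  neighbourhood v with intervals (Vec.map (adj G v) L)
  ... | Is , len , cov = Is , ≤-trans len (alt≤ v) , λ u →
    subst (λ b → (b ≡ true) ⇔ Any (InInterval (pos u)) Is)
          (≡.trans (lookup-map (pos u) (adj G v) L) (cong (adj G v) (≡.sym (lookup-pos u)))) (cov (pos u))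

-- Rounding the logarithm down loses a factor below 2, which the doubled exponent absorbs because
-- the logarithm is at least 1.
n≤4^log : ∀ {n} → 2 ≤ n → n ≤ 2 ^ (2 * ⌊log₂ n ⌋)
n≤4^log {n} n≥2 = begin
  n                                 ≤⟨ <⇒≤ n< ⟩
  2 ^ (1 + ⌊log₂ n ⌋)               ≤⟨ ^-monoʳ-≤ 2 (+-monoˡ-≤ ⌊log₂ n ⌋ (⌊log₂⌋-mono-≤ n≥2)) ⟩
  2 ^ (⌊log₂ n ⌋ + ⌊log₂ n ⌋)       ≡⟨ cong (λ t → 2 ^ (⌊log₂ n ⌋ + t)) (+-identityʳ ⌊log₂ n ⌋) ⟨
  2 ^ (2 * ⌊log₂ n ⌋) ∎
  where
  open ≤-Reasoning
  n< : n < 2 ^ suc ⌊log₂ n ⌋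
  n< = ≰⇒> λ 2^≤n → n≮n ⌊log₂ n ⌋ (subst (_≤ ⌊log₂ n ⌋) (⌊log₂[2^n]⌋≡n (suc ⌊log₂ n ⌋)) (⌊log₂⌋-mono-≤ 2^≤n))

theorem4p4 : (X : GraphProp) → IsClass X → Hereditary X → Small X →
    ∃[ C ] ∃[ N ] ∀ n → N ≤ n → (G : Graph n) → X n G →
    CtgAtMost (C * (⌊log₂ n ⌋ ^ 2)) G
-- With `l = ⌊log₂ n⌋` the bound comes out as 1 + 4l + 4Kl², which is at most (4K + 5)l² because
-- `l ≥ 1` from `n = 2` on.
theorem4p4 X _ hereditary (c , small) = 4 * K + 5 , 2 , contiguity
  where
  K = pairConstant c
  contiguity : ∀ n → 2 ≤ n → (G : Graph n) → X n G → CtgAtMost ((4 * K + 5) * (⌊log₂ n ⌋ ^ 2)) G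
  contiguity n@(suc m) n≥2 G XG
    with Ordering.order G (K * ⌊log₂ n ⌋) close-pair m (allFin n) (length-tabulate (λ i → i)) (allFin n)
    where open ClosePairs X hereditary c small G XG ⌊log₂ n ⌋ (⌊log₂⌋-mono-≤ n≥2) (n≤4^log n≥2)
  ... | L , ∈L , crossings = order⇒contiguity G L (λ u → ∈L (∈-allFin u)) alternations≤
    where
    open ≤-Reasoning
    l = ⌊log₂ n ⌋
    l≥1 : 1 ≤ l
    l≥1 = ⌊log₂⌋-mono-≤ n≥2
    -- The initial weights are 1 for each vertex and `n` in total, so the number `j` of doublings
    -- satisfies 2^j ≤ n^(Kl+1), and n ≤ 2^(2l).
    exponent≤ : ∀ v j → count v (allFin n) * 2 ^ j ≤ length (allFin n) * n ^ (K * l) → j ≤ 2 * l * suc (K * l)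
    exponent≤ v j bound = ≮⇒≥ λ j> → n≮n (2 ^ j) (begin-strict
      2 ^ j                                   ≡⟨ *-identityˡ (2 ^ j) ⟨
      1 * 2 ^ j                               ≤⟨ *-monoˡ-≤ (2 ^ j) (∈⇒count>0 (∈-allFin v)) ⟩
      count v (allFin n) * 2 ^ j              ≤⟨ bound ⟩
      length (allFin n) * n ^ (K * l)         ≡⟨ cong (_* n ^ (K * l)) (length-tabulate {n = n} (λ i → i)) ⟩
      n ^ suc (K * l)                         ≤⟨ ^-monoˡ-≤ (suc (K * l)) (n≤4^log n≥2) ⟩
      (2 ^ (2 * l)) ^ suc (K * l)             ≡⟨ ^-*-assoc 2 (2 * l) (suc (K * l)) ⟩
      2 ^ (2 * l * suc (K * l))               <⟨ ^-monoʳ-< 2 (s≤s (s≤s z≤n)) j> ⟩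
      2 ^ j ∎)
    alternations≤ : ∀ v → suc (alternations (Vec.map (adj G v) L)) ≤ (4 * K + 5) * l ^ 2
    alternations≤ v with crossings v
    ... | j , alt , bound = begin
      suc (alternations (Vec.map (adj G v) L))   ≤⟨ s≤s alt ⟩
      suc (2 * j)                                ≤⟨ s≤s (*-monoʳ-≤ 2 (exponent≤ v j bound)) ⟩
      1 + 2 * (2 * l * suc (K * l))              ≡⟨ expand K l ⟩
      4 * K * (l * l) + (1 * 1 + 4 * l * 1)
        ≤⟨ +-monoʳ-≤ (4 * K * (l * l)) (+-mono-≤ (*-mono-≤ l≥1 l≥1) (*-monoʳ-≤ (4 * l) l≥1)) ⟩
      4 * K * (l * l) + (l * l + 4 * l * l)      ≡⟨ collect K l ⟩
      (4 * K + 5) * (l * (l * 1)) ∎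
      where
      expand : ∀ K l → 1 + 2 * (2 * l * suc (K * l)) ≡ 4 * K * (l * l) + (1 * 1 + 4 * l * 1)
      expand = solve-∀
      collect : ∀ K l → 4 * K * (l * l) + (l * l + 4 * l * l) ≡ (4 * K + 5) * (l * (l * 1))
      collect = solve-∀
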